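{- Let $q$ be a prime power. In each part below assume $k\leq\binom{n}{2}$. (i) If $n=k=q^2+q+1$, then $M(k,n)=(q^2+q+1)q=qk=\frac{2}{q+1}\binom{n}{2}$. (ii) If $n=q^2$ and $k=q^2+q$, then $M(k,n)=(q+1)q(q-1)=(q-1)k=\frac{2}{q}\binom{n}{2}$. (iii) If $n=q^2+q$ and $k=q^2+q+1$, then $M(k,n)=q^3+q^2-1=qk-q-1$. (iv) If $n=q^2-1$ and $k=q^2+q$, then $M(k,n)=q^3-2q-1=(q-1)k-q-1$. (v) If $n=q^2-q$ and $k=q^2+q-1$, then $M(k,n)=q^3-q^2-2q+1=(q-2)k+q-1$.
   Context: For a finite graph $G$, $\mathrm{Mad}(G)=\max\{2e(H)/|V(H)| : H\subseteq G,\ |V(H)|\geq 1\}$ ($0$ if edgeless). For $1\leq k\leq\binom{n}{2}$, $M(k,n)$ is the maximum of $\sum_{i=1}^k\mathrm{Mad}(G_i)$ over all partitions of $E(K_n)$ into $k$ spanning subgraphs $G_1,\dots,G_k$. -}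

module Defs where

open import Data.Bool using (Bool; true; false; _∧_; T)
open import Data.Nat using (ℕ; zero; suc; _+_; _*_; _^_; _≤_; _<ᵇ_)
open import Data.Nat.Primality using (Prime)
open import Data.Nat.Combinatorics using (_C_)
open import Data.Fin using (Fin; toℕ; zero; suc)
open import Data.Fin.Properties using () renaming (_≟_ to _≟ᶠ_)
open import Data.List using (List; length; filterᵇ; cartesianProduct; allFin)
open import Data.Product using (Σ; ∃; _×_; _,_; proj₁; proj₂)
open import Data.Integer using (ℤ; +_)
open import Relation.Binary.PropositionalEquality using (_≡_)
open import Relation.Nullary.Decidable using (⌊_⌋)
import Data.Rational as ℚ
open ℚ using (ℚ)

IsPrimePower : ℕ → Set
IsPrimePower q = Σ ℕ λ p → Σ ℕ λ e → Prime p × 1 ≤ e × q ≡ p ^ e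

-- A graph on vertex set Fin n is given by a Boolean adjacency function;
-- only the values G i j with toℕ i < toℕ j are ever read, i.e. the edge
-- {i , j} of K_n (i < j) belongs to G iff G i j ≡ true.
Graph : ℕ → Set
Graph n = Fin n → Fin n → Bool

edgesK : (n : ℕ) → List (Fin n × Fin n)
edgesK n = filterᵇ (λ p → toℕ (proj₁ p) <ᵇ toℕ (proj₂ p))
                   (cartesianProduct (allFin n) (allFin n))

numEdges : {n : ℕ} → Graph n → ℕ
numEdges {n} G = length (filterᵇ (λ p → G (proj₁ p) (proj₂ p)) (edgesK n))

numVerts : {n : ℕ} → (Fin n → Bool) → ℕ
numVerts {n} S = length (filterᵇ S (allFin n))

record Subgraph {n : ℕ} (G : Graph n) : Set where
  field
    verts : Fin n → Bool
    edges : Graph n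
    edges⊆ : ∀ (i j : Fin n) → toℕ i Data.Nat.< toℕ j → T (edges i j) →
             T (G i j) × T (verts i) × T (verts j)
open Subgraph public

-- a / b as a rational (only used with b ≥ 1)
ratio : ℕ → ℕ → ℚ
ratio a zero = ℚ.0ℚ
ratio a (suc b) = (+ a) ℚ./ suc b

density : {n : ℕ} {G : Graph n} → Subgraph G → ℚ
density H = ratio (2 * numEdges (edges H)) (numVerts (verts H))

-- r = Mad(G): r is the maximum of 2e(H)/|V(H)| over subgraphs H with |V(H)| ≥ 1
-- (for an edgeless G on n ≥ 1 vertices this maximum is 0, as in the paper)
IsMad : {n : ℕ} → Graph n → ℚ → Set
IsMad G r =
  (Σ (Subgraph G) λ H → 1 ≤ numVerts (verts H) × density H ≡ r) ×
  (∀ (H : Subgraph G) → 1 ≤ numVerts (verts H) → density H ℚ.≤ r)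

-- a partition of E(K_n) into k spanning subgraphs G_0 … G_{k-1}:
-- each edge {i , j} (i < j) receives the label c i j : Fin k
Partition : ℕ → ℕ → Set
Partition k n = Fin n → Fin n → Fin k

part : {k n : ℕ} → Partition k n → Fin k → Graph n
part c a i j = ⌊ c i j ≟ᶠ a ⌋

sumFin : (k : ℕ) → (Fin k → ℚ) → ℚ
sumFin zero f = ℚ.0ℚ
sumFin (suc k) f = f zero ℚ.+ sumFin k (λ a → f (suc a))

IsM : ℕ → ℕ → ℚ → Set
IsM k n v =
  (Σ (Partition k n) λ c → Σ (Fin k → ℚ) λ r →
      (∀ a → IsMad (part c a) (r a)) × sumFin k r ≡ v) ×
  (∀ (c : Partition k n) (r : Fin k → ℚ) →
      (∀ a → IsMad (part c a) (r a)) → sumFin k r ℚ.≤ v)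

ℤtoℚ : ℤ → ℚ
ℤtoℚ z = z ℚ./ 1

{-# OPTIONS --safe #-}
module Submission where

-- Upper bound: a subgraph with v vertices and e edges satisfies 2e ≤ v (v − 1), and this makes its
-- average degree d = 2e/v satisfy 2 t d ≤ 2e + t (t − 1) for every integer t ≥ 1.  Summing over the
-- colour classes bounds ∑ Mad; the bound is sharp when every class is a clique on t or t + 1 vertices.
--
-- Lower bound: colour the edges by the lines of a linear space in which every point lies on q + 1
-- lines.  Each class is then a clique, and ∑ (|ℓ| − 1) = n (q + 1) − k by counting incidences.  The
-- five spaces are the projective and the affine plane of order q, these planes without a point, and
-- the affine plane without a line.
--
-- The planes need a field with q = pʰ elements.  In the group algebra R = (ℤ/p)[X]/(X^(q−1) − 1) every
-- element satisfies y^q = y, because the Frobenius map is additive.  The product P of the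
-- X^(p^d) − X for 0 < d < h is nonzero in R by degree, and a primitive idempotent e below P^(q−1)
-- makes F = R/(1 − e) a field in which the image of X has h distinct conjugates.  Hence 1, X, …, X^(h−1)
-- are independent over ℤ/p in F, and |F| ≥ q; as y^q = y has at most q solutions, |F| = q.

-- The inequality for d clears to (v - t)(v - t - 1) ≥ 0, which explains the two equality cases v =
-- t and v = t + 1. Its right-hand side is linear in e on purpose, since the total number of edges
-- is all that is known about the classes. In each of the five spaces the line sizes take at most
-- two consecutive values, so one t serves all lines: t = q for the planes and the projective plane
-- without a point, t = q - 1 for the affine plane without a point or a line. The obstacle is a
-- field of every prime power order. The usual sources, an irreducible polynomial of degree h or a
-- splitting field, would have to be found first. In R the identity y^q = y holds from the start, so
-- every y^(q-1) is idempotent and one pass over the finitely many elements reaches a primitive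
-- idempotent. An arbitrary one may give too small a field; the summand on which X acts as 1, for
-- instance, is just ℤ/p. Keeping e below P^(q-1) keeps every factor X^(p^d) - X nonzero in F, so
-- that X is fixed by no smaller power of Frobenius.

module FiniteFields where
  open import Algebra.Bundles using (CommutativeRing; Semiring)
  open import Algebra.Definitions using (Associative; Commutative; LeftIdentity)
  import Algebra.Properties.CommutativeSemigroup as SemigroupProperties
  import Algebra.Properties.CommutativeSemiring.Binomial as Binomial
  import Algebra.Properties.CommutativeSemiring.Exp as CommutativeSemiringExp
  import Algebra.Properties.Group as GroupProperties
  import Algebra.Properties.Ring as RingProperties
  import Algebra.Properties.Semiring.Exp as SemiringExp
  import Algebra.Properties.Semiring.Mult as SemiringMult
  import Algebra.Properties.Semiring.Sum as SemiringSum
  import Algebra.Solver.Ring.NaturalCoefficients.Default as SemiringSolver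
  open import Data.Bool.Base using (if_then_else_)
  open import Data.Fin.Base using (Fin; zero; suc; toℕ; fromℕ; fromℕ<; inject₁; remQuot; combine)
  import Data.Fin.Properties as Fin
  open import Data.Integer.Base as ℤ using (ℤ; -[1+_]) renaming (+_ to pos)
  import Data.Integer.DivMod as ℤ
  import Data.Integer.Divisibility.Signed as ℤ
  import Data.Integer.Properties as ℤ
  open import Data.Integer.Tactic.RingSolver using () renaming (solve-∀ to ℤ-solve-∀)
  open import Data.List.Base using (List; []; _∷_; cartesianProductWith; map; upTo)
  import Data.List.Membership.Propositional.Properties as Membership
  open import Data.List.Relation.Unary.All as ListAll using ([]; _∷_)
  open import Data.List.Relation.Unary.Any as Any using (Any; here)
  import Data.List.Relation.Unary.Any.Properties as Any
  open import Data.Nat.Base as ℕ using (ℕ; zero; suc)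
  open import Data.Nat.Combinatorics using (_C_; nCn≡1; nC1≡n; nCk+nC[k+1]≡[n+1]C[k+1]; k>n⇒nCk≡0)
  open import Data.Nat.Coprimality as Coprimality using (Coprime; coprime-Bézout; prime⇒coprime)
  import Data.Nat.DivMod as ℕ
  open import Data.Nat.Divisibility using (_∣_; divides; ∣⇒≤; ∣1⇒≡1)
  import Data.Nat.GCD as GCD
  open import Data.Nat.Primality using (Prime; euclidsLemma; prime⇒nonZero; prime⇒nonTrivial)
  import Data.Nat.Properties as ℕ
  open import Data.Nat.Tactic.RingSolver using () renaming (solve-∀ to ℕ-solve-∀)
  open import Data.Product.Base using (_×_; _,_; ∃; proj₁; proj₂)
  open import Data.Sum.Base using (_⊎_; inj₁; inj₂)
  open import Data.Vec.Base using (Vec; []; _∷_; zipWith)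
  import Data.Vec.Functional as Vector
  open import Data.Vec.Relation.Unary.All using (All; []; _∷_)
  open import Function.Base using (_∘_)
  open import Level using (0ℓ)
  open import Relation.Binary.Definitions using (tri<; tri≈; tri>)
  open import Relation.Binary.PropositionalEquality as ≡ using (_≡_; _≢_; cong; cong₂)
  import Relation.Binary.Reasoning.Setoid as SetoidReasoning
  open import Relation.Binary.Structures using (IsEquivalence)
  open import Relation.Nullary.Decidable.Core using (Dec; yes; no; does; map′)
  open import Relation.Nullary.Negation using (¬_; contradiction)

  -- Quotients of commutative rings by congruences

  Ring : Set₁
  Ring = CommutativeRing 0ℓ 0ℓ

  record Congruence (A : Ring) : Set₁ where
    open CommutativeRing A
    field
      _∼_ : Carrier → Carrier → Set
      ∼-equiv : IsEquivalence _∼_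
      ≈⇒∼ : ∀ {x y} → x ≈ y → x ∼ y
      +-cong∼ : ∀ {x y u v} → x ∼ y → u ∼ v → (x + u) ∼ (y + v)
      *-cong∼ : ∀ {x y u v} → x ∼ y → u ∼ v → (x * u) ∼ (y * v)
      neg-cong∼ : ∀ {x y} → x ∼ y → (- x) ∼ (- y)

  -- Only the equality is coarsened; carrier and operations stay. Both ℤ/p and the residue field
  -- arise this way, without a choice of representatives.
  quotient : (A : Ring) → Congruence A → Ring
  quotient A C = record
    { Carrier = Carrier ; _≈_ = _∼_ ; _+_ = _+_ ; _*_ = _*_ ; -_ = -_ ; 0# = 0# ; 1# = 1#
    ; isCommutativeRing = record
      { isRing = record
        { +-isAbelianGroup = record
          { isGroup = record
            { isMonoid = record
              { isSemigroup = record
                { isMagma = record { isEquivalence = ∼-equiv ; ∙-cong = +-cong∼ }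
                ; assoc = λ x y z → ≈⇒∼ (+-assoc x y z) }
              ; identity = (λ x → ≈⇒∼ (+-identityˡ x)) , (λ x → ≈⇒∼ (+-identityʳ x)) }
            ; inverse = (λ x → ≈⇒∼ (-‿inverseˡ x)) , (λ x → ≈⇒∼ (-‿inverseʳ x))
            ; ⁻¹-cong = neg-cong∼ }
          ; comm = λ x y → ≈⇒∼ (+-comm x y) }
        ; *-cong = *-cong∼
        ; *-assoc = λ x y z → ≈⇒∼ (*-assoc x y z)
        ; *-identity = (λ x → ≈⇒∼ (*-identityˡ x)) , (λ x → ≈⇒∼ (*-identityʳ x))
        ; distrib = (λ x y z → ≈⇒∼ (distribˡ x y z)) , (λ x y z → ≈⇒∼ (distribʳ x y z)) }
      ; *-comm = λ x y → ≈⇒∼ (*-comm x y) } }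
    where
    open CommutativeRing A
    open Congruence C

  -- Finite sums with Kronecker deltas, and monoid algebras

  module Sums (K : Semiring 0ℓ 0ℓ) where
    open Semiring K hiding (zero)
    open SemiringSum K public

    δ : ∀ {n} → Fin n → Fin n → Carrier
    δ i j = if does (i Fin.≟ j) then 1# else 0#

    sum-zero : ∀ {n} (f : Fin n → Carrier) → (∀ i → f i ≈ 0#) → sum f ≈ 0#
    sum-zero {n} f f≈0 = trans (sum-cong-≋ f≈0) (sum-replicate-zero n)

    sum-δ : ∀ {n} (i : Fin n) (f : Fin n → Carrier) → sum (λ j → δ i j * f j) ≈ f i
    sum-δ zero f = trans (+-cong (*-identityˡ _) (sum-zero _ (λ j → zeroˡ (f (suc j))))) (+-identityʳ _)
    sum-δ (suc i) f = trans (+-cong (zeroˡ _) (sum-δ i (λ j → f (suc j)))) (+-identityˡ _)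

    sum-δʳ : ∀ {n} (f : Fin n → Carrier) (i : Fin n) → sum (λ j → f j * δ j i) ≈ f i
    sum-δʳ f zero = trans (+-cong (*-identityʳ _) (sum-zero _ (λ j → zeroʳ (f (suc j))))) (+-identityʳ _)
    sum-δʳ f (suc i) = trans (+-cong (zeroʳ _) (sum-δʳ (λ j → f (suc j)) i)) (+-identityˡ _)

  module MonoidAlgebra (K : Ring) {N : ℕ} (_⊕_ : Fin N → Fin N → Fin N) (o : Fin N)
    (⊕-assoc : Associative _≡_ _⊕_) (⊕-comm : Commutative _≡_ _⊕_) (⊕-identityˡ : LeftIdentity _≡_ o _⊕_) where
    open CommutativeRing K
    open Sums semiring
    open SetoidReasoning setoid
    open SemiringSolver commutativeSemiring using (solve; _:=_; _:+_; _:*_)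

    infixl 7 _⊛_
    -- Convolution, with the condition i ⊕ j = k carried by an indicator: no subtraction in the
    -- index monoid is involved, and sums can be exchanged freely.
    _⊛_ : (Fin N → Carrier) → (Fin N → Carrier) → Fin N → Carrier
    (f ⊛ g) k = sum λ i → sum λ j → (f i * g j) * δ (i ⊕ j) k

    private
      sum₂-cong : {f g : Fin N → Fin N → Carrier} → (∀ i j → f i j ≈ g i j) →
                  sum (λ i → sum (f i)) ≈ sum (λ i → sum (g i))
      sum₂-cong eq = sum-cong-≋ (λ i → sum-cong-≋ (eq i))

    -- ∑ₖ (f ⊛ g)ₖ φ(k) expands without the coefficients of f ⊛ g: associativity becomes the
    -- special case where φ is itself a translate of δ paired with a third function.
    ⊛-pairing : ∀ f g (φ : Fin N → Carrier) →
           sum (λ k → (f ⊛ g) k * φ k) ≈ sum (λ i → sum λ j → (f i * g j) * φ (i ⊕ j))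
    ⊛-pairing f g φ = begin
      sum (λ k → (f ⊛ g) k * φ k)
        ≈⟨ sum-cong-≋ (λ k → trans (*-distribʳ-sum (φ k) (λ i → sum λ j → (f i * g j) * δ (i ⊕ j) k))
             (sum-cong-≋ λ i → *-distribʳ-sum (φ k) (λ j → (f i * g j) * δ (i ⊕ j) k))) ⟩
      sum (λ k → sum λ i → sum λ j → ((f i * g j) * δ (i ⊕ j) k) * φ k)
        ≈⟨ ∑-comm (λ k i → sum λ j → ((f i * g j) * δ (i ⊕ j) k) * φ k) ⟩
      sum (λ i → sum λ k → sum λ j → ((f i * g j) * δ (i ⊕ j) k) * φ k)
        ≈⟨ sum-cong-≋ (λ i → ∑-comm (λ k j → ((f i * g j) * δ (i ⊕ j) k) * φ k)) ⟩
      sum (λ i → sum λ j → sum λ k → ((f i * g j) * δ (i ⊕ j) k) * φ k)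
        ≈⟨ sum₂-cong (λ i j → trans (sum-cong-≋ (λ k → *-assoc (f i * g j) (δ (i ⊕ j) k) (φ k)))
             (sym (*-distribˡ-sum (f i * g j) (λ k → δ (i ⊕ j) k * φ k)))) ⟩
      sum (λ i → sum λ j → (f i * g j) * sum (λ k → δ (i ⊕ j) k * φ k))
        ≈⟨ sum₂-cong (λ i j → *-congˡ (sum-δ (i ⊕ j) φ)) ⟩
      sum (λ i → sum λ j → (f i * g j) * φ (i ⊕ j)) ∎

    ⊛-cong : ∀ {f f′ g g′} → (∀ i → f i ≈ f′ i) → (∀ i → g i ≈ g′ i) → ∀ k → (f ⊛ g) k ≈ (f′ ⊛ g′) k
    ⊛-cong p r k = sum₂-cong (λ i j → *-congʳ (*-cong (p i) (r j)))

    ⊛-comm : ∀ f g k → (f ⊛ g) k ≈ (g ⊛ f) k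
    ⊛-comm f g k = trans (∑-comm (λ i j → (f i * g j) * δ (i ⊕ j) k))
      (sum₂-cong (λ j i → *-cong (*-comm (f i) (g j)) (reflexive (≡.cong (λ m → δ m k) (⊕-comm i j)))))

    ⊛-assoc : ∀ f g h k → ((f ⊛ g) ⊛ h) k ≈ (f ⊛ (g ⊛ h)) k
    ⊛-assoc f g h k = begin
      ((f ⊛ g) ⊛ h) k
        ≈⟨ sum-cong-≋ (λ i → trans (sum-cong-≋ (λ j → *-assoc ((f ⊛ g) i) (h j) (δ (i ⊕ j) k)))
             (sym (*-distribˡ-sum ((f ⊛ g) i) (λ j → h j * δ (i ⊕ j) k)))) ⟩
      sum (λ i → (f ⊛ g) i * sum (λ j → h j * δ (i ⊕ j) k))
        ≈⟨ ⊛-pairing f g (λ i → sum (λ j → h j * δ (i ⊕ j) k)) ⟩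
      sum (λ a → sum λ b → (f a * g b) * sum (λ j → h j * δ ((a ⊕ b) ⊕ j) k))
        ≈⟨ sum₂-cong inner ⟩
      sum (λ a → sum λ b → f a * sum (λ j → (g b * h j) * δ (a ⊕ (b ⊕ j)) k))
        ≈⟨ sum-cong-≋ (λ a → sym (*-distribˡ-sum (f a) (λ b → sum (λ j → (g b * h j) * δ (a ⊕ (b ⊕ j)) k)))) ⟩
      sum (λ a → f a * sum (λ b → sum (λ j → (g b * h j) * δ (a ⊕ (b ⊕ j)) k)))
        ≈⟨ sum-cong-≋ (λ a → *-congˡ (sym (⊛-pairing g h (λ i → δ (a ⊕ i) k)))) ⟩
      sum (λ a → f a * sum (λ i → (g ⊛ h) i * δ (a ⊕ i) k))
        ≈⟨ sum-cong-≋ (λ a → trans (*-distribˡ-sum (f a) (λ i → (g ⊛ h) i * δ (a ⊕ i) k))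
             (sum-cong-≋ λ i → sym (*-assoc (f a) ((g ⊛ h) i) (δ (a ⊕ i) k)))) ⟩
      (f ⊛ (g ⊛ h)) k ∎
      where
      shuffle : ∀ u v w x → (u * v) * (w * x) ≈ u * ((v * w) * x)
      shuffle = solve 4 (λ u v w x → (u :* v) :* (w :* x) := u :* ((v :* w) :* x)) refl
      inner : ∀ a b → (f a * g b) * sum (λ j → h j * δ ((a ⊕ b) ⊕ j) k) ≈
                      f a * sum (λ j → (g b * h j) * δ (a ⊕ (b ⊕ j)) k)
      inner a b = begin
        (f a * g b) * sum (λ j → h j * δ ((a ⊕ b) ⊕ j) k)
          ≈⟨ *-distribˡ-sum (f a * g b) (λ j → h j * δ ((a ⊕ b) ⊕ j) k) ⟩
        sum (λ j → (f a * g b) * (h j * δ ((a ⊕ b) ⊕ j) k))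
          ≈⟨ sum-cong-≋ (λ j → trans (shuffle (f a) (g b) (h j) (δ ((a ⊕ b) ⊕ j) k))
               (*-congˡ (*-congˡ (reflexive (≡.cong (λ m → δ m k) (⊕-assoc a b j)))))) ⟩
        sum (λ j → f a * ((g b * h j) * δ (a ⊕ (b ⊕ j)) k))
          ≈⟨ sym (*-distribˡ-sum (f a) (λ j → (g b * h j) * δ (a ⊕ (b ⊕ j)) k)) ⟩
        f a * sum (λ j → (g b * h j) * δ (a ⊕ (b ⊕ j)) k) ∎

    ⊛-distribʳ : ∀ f g h k → ((λ i → g i + h i) ⊛ f) k ≈ (g ⊛ f) k + (h ⊛ f) k
    ⊛-distribʳ f g h k = begin
      ((λ i → g i + h i) ⊛ f) k
        ≈⟨ sum₂-cong (λ i j → expand (g i) (h i) (f j) (δ (i ⊕ j) k)) ⟩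
      sum (λ i → sum λ j → (g i * f j) * δ (i ⊕ j) k + (h i * f j) * δ (i ⊕ j) k)
        ≈⟨ sum-cong-≋ (λ i → ∑-distrib-+ (λ j → (g i * f j) * δ (i ⊕ j) k) (λ j → (h i * f j) * δ (i ⊕ j) k)) ⟩
      sum (λ i → sum (λ j → (g i * f j) * δ (i ⊕ j) k) + sum (λ j → (h i * f j) * δ (i ⊕ j) k))
        ≈⟨ ∑-distrib-+ (λ i → sum (λ j → (g i * f j) * δ (i ⊕ j) k)) (λ i → sum (λ j → (h i * f j) * δ (i ⊕ j) k)) ⟩
      (g ⊛ f) k + (h ⊛ f) k ∎
      where
      expand : ∀ u v w x → ((u + v) * w) * x ≈ (u * w) * x + (v * w) * x
      expand = solve 4 (λ u v w x → ((u :+ v) :* w) :* x := (u :* w) :* x :+ (v :* w) :* x) refl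

    δ-⊛ : ∀ a f k → (δ a ⊛ f) k ≈ sum (λ j → f j * δ (a ⊕ j) k)
    δ-⊛ a f k = begin
      (δ a ⊛ f) k
        ≈⟨ sum-cong-≋ (λ i → trans (sum-cong-≋ (λ j → *-assoc (δ a i) (f j) (δ (i ⊕ j) k)))
             (sym (*-distribˡ-sum (δ a i) (λ j → f j * δ (i ⊕ j) k)))) ⟩
      sum (λ i → δ a i * sum (λ j → f j * δ (i ⊕ j) k))
        ≈⟨ sum-δ a (λ i → sum (λ j → f j * δ (i ⊕ j) k)) ⟩
      sum (λ j → f j * δ (a ⊕ j) k) ∎

    ⊛-identityˡ : ∀ f k → (δ o ⊛ f) k ≈ f k
    ⊛-identityˡ f k = trans (δ-⊛ o f k)
      (trans (sum-cong-≋ (λ j → *-congˡ (reflexive (≡.cong (λ m → δ m k) (⊕-identityˡ j))))) (sum-δʳ f k))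

    algebra : Ring
    algebra = record
      { Carrier = Fin N → Carrier
      ; _≈_ = λ f g → ∀ i → f i ≈ g i
      ; _+_ = λ f g i → f i + g i
      ; _*_ = _⊛_
      ; -_ = λ f i → - f i
      ; 0# = λ _ → 0#
      ; 1# = δ o
      ; isCommutativeRing = record
        { isRing = record
          { +-isAbelianGroup = record
            { isGroup = record
              { isMonoid = record
                { isSemigroup = record
                  { isMagma = record
                    { isEquivalence = record
                      { refl = λ _ → refl ; sym = λ p i → sym (p i) ; trans = λ p r i → trans (p i) (r i) }
                    ; ∙-cong = λ p r i → +-cong (p i) (r i) }
                  ; assoc = λ f g h i → +-assoc (f i) (g i) (h i) }
                ; identity = (λ f i → +-identityˡ (f i)) , (λ f i → +-identityʳ (f i)) }
              ; inverse = (λ f i → -‿inverseˡ (f i)) , (λ f i → -‿inverseʳ (f i))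
              ; ⁻¹-cong = λ p i → -‿cong (p i) }
            ; comm = λ f g i → +-comm (f i) (g i) }
          ; *-cong = ⊛-cong
          ; *-assoc = ⊛-assoc
          ; *-identity = ⊛-identityˡ , (λ f k → trans (⊛-comm f (δ o) k) (⊛-identityˡ f k))
          ; distrib = (λ f g h k → trans (⊛-comm f (λ i → g i + h i) k)
                         (trans (⊛-distribʳ f g h k) (+-cong (⊛-comm g f k) (⊛-comm h f k))))
                    , ⊛-distribʳ }
        ; *-comm = ⊛-comm } }

    open CommutativeRing algebra using () renaming (_≈_ to _≋_)
    open SemiringSum (CommutativeRing.semiring algebra) using () renaming (sum to ∑ᴬ)
    open import Algebra.Properties.Semiring.Exp (CommutativeRing.semiring algebra)
      using () renaming (_^_ to _^ᴬ_)
    open import Algebra.Properties.Semiring.Exp semiring using (_^_)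

    infixr 7 _·_
    _·_ : Carrier → (Fin N → Carrier) → Fin N → Carrier
    (c · f) i = c * f i

    δ-⊛-δ : ∀ a b → δ a ⊛ δ b ≋ δ (a ⊕ b)
    δ-⊛-δ a b k = trans (δ-⊛ a (δ b) k) (sum-δ b (λ j → δ (a ⊕ j) k))

    ·-⊛-· : ∀ c d f g → (c · f) ⊛ (d · g) ≋ (c * d) · (f ⊛ g)
    ·-⊛-· c d f g k = begin
      ((c · f) ⊛ (d · g)) k
        ≈⟨ sum₂-cong (λ i j → shuffle c d (f i) (g j) (δ (i ⊕ j) k)) ⟩
      sum (λ i → sum λ j → (c * d) * ((f i * g j) * δ (i ⊕ j) k))
        ≈⟨ sum-cong-≋ (λ i → sym (*-distribˡ-sum (c * d) (λ j → (f i * g j) * δ (i ⊕ j) k))) ⟩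
      sum (λ i → (c * d) * sum λ j → (f i * g j) * δ (i ⊕ j) k)
        ≈⟨ sym (*-distribˡ-sum (c * d) (λ i → sum λ j → (f i * g j) * δ (i ⊕ j) k)) ⟩
      (c * d) * (f ⊛ g) k ∎
      where
      shuffle : ∀ c d u v x → ((c * u) * (d * v)) * x ≈ (c * d) * ((u * v) * x)
      shuffle = solve 5 (λ c d u v x → ((c :* u) :* (d :* v)) :* x := (c :* d) :* ((u :* v) :* x)) refl

    ·-^ : ∀ c f n → (c · f) ^ᴬ n ≋ (c ^ n) · (f ^ᴬ n)
    ·-^ c f zero k = sym (*-identityˡ _)
    ·-^ c f (suc n) k = trans (⊛-cong {c · f} (λ _ → refl) (·-^ c f n) k) (·-⊛-· c (c ^ n) f (f ^ᴬ n) k)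

    ∑ᴬ-pointwise : ∀ {m} (fs : Fin m → Fin N → Carrier) k → ∑ᴬ fs k ≈ sum (λ i → fs i k)
    ∑ᴬ-pointwise {zero} fs k = refl
    ∑ᴬ-pointwise {suc m} fs k = +-congˡ (∑ᴬ-pointwise (λ i → fs (suc i)) k)

    basis-expansion : ∀ f → f ≋ ∑ᴬ (λ i → f i · δ i)
    basis-expansion f k = sym (trans (∑ᴬ-pointwise (λ i → f i · δ i) k) (sum-δʳ f k))

  -- Binomial coefficients and the Frobenius map in characteristic p

  absorption : ∀ n k → suc k ℕ.* (suc n C suc k) ≡ suc n ℕ.* (n C k)
  absorption zero zero = ≡.refl
  absorption zero (suc k) = ≡.trans (cong (suc (suc k) ℕ.*_) (k>n⇒nCk≡0 {1} {2 ℕ.+ k} (ℕ.s≤s (ℕ.s≤s ℕ.z≤n))))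
    (≡.trans (ℕ.*-zeroʳ (2 ℕ.+ k)) (≡.sym (cong (1 ℕ.*_) (k>n⇒nCk≡0 {0} {suc k} (ℕ.s≤s ℕ.z≤n)))))
  absorption (suc n) zero = ≡.trans (ℕ.*-identityˡ _) (≡.trans (nC1≡n (2 ℕ.+ n)) (≡.sym (ℕ.*-identityʳ _)))
  absorption (suc n) (suc k) = begin
    suc (suc k) ℕ.* (suc (suc n) C suc (suc k))
      ≡⟨ cong (suc (suc k) ℕ.*_) (nCk+nC[k+1]≡[n+1]C[k+1] (suc n) (suc k)) ⟨
    suc (suc k) ℕ.* ((suc n C suc k) ℕ.+ (suc n C suc (suc k)))
      ≡⟨ split (suc k) (suc n C suc k) (suc n C suc (suc k)) ⟩
    (suc k ℕ.* (suc n C suc k) ℕ.+ suc (suc k) ℕ.* (suc n C suc (suc k))) ℕ.+ (suc n C suc k)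
      ≡⟨ cong (ℕ._+ (suc n C suc k)) (cong₂ ℕ._+_ (absorption n k) (absorption n (suc k))) ⟩
    (suc n ℕ.* (n C k) ℕ.+ suc n ℕ.* (n C suc k)) ℕ.+ (suc n C suc k)
      ≡⟨ cong (ℕ._+ (suc n C suc k)) (≡.sym (ℕ.*-distribˡ-+ (suc n) (n C k) (n C suc k))) ⟩
    suc n ℕ.* ((n C k) ℕ.+ (n C suc k)) ℕ.+ (suc n C suc k)
      ≡⟨ cong (λ c → suc n ℕ.* c ℕ.+ (suc n C suc k)) (nCk+nC[k+1]≡[n+1]C[k+1] n k) ⟩
    suc n ℕ.* (suc n C suc k) ℕ.+ (suc n C suc k)
      ≡⟨ ℕ.+-comm (suc n ℕ.* (suc n C suc k)) (suc n C suc k) ⟩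
    suc (suc n) ℕ.* (suc n C suc k) ∎
    where
    open ≡.≡-Reasoning
    split : ∀ a b c → (1 ℕ.+ a) ℕ.* (b ℕ.+ c) ≡ (a ℕ.* b ℕ.+ (1 ℕ.+ a) ℕ.* c) ℕ.+ b
    split = ℕ-solve-∀

  -- By absorption p divides the product of k + 1 and the binomial coefficient, and it cannot divide
  -- the smaller number k + 1.
  p∣pCk : ∀ {p} → Prime p → ∀ k → suc k ℕ.< p → p ∣ (p C suc k)
  p∣pCk {suc p} p-prime k k<p with euclidsLemma (suc k) (suc p C suc k) p-prime
    (divides (p C k) (≡.trans (absorption p k) (ℕ.*-comm (suc p) (p C k))))
  ... | inj₁ p∣k = contradiction (∣⇒≤ p∣k) (ℕ.<⇒≱ k<p)
  ... | inj₂ p∣C = p∣C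

  module Characteristic (A : Ring) {p : ℕ} (p-prime : Prime p)
    (char : CommutativeRing._≈_ A (SemiringMult._×_ (CommutativeRing.semiring A) p (CommutativeRing.1# A)) (CommutativeRing.0# A)) where
    open CommutativeRing A hiding (zero)
    open SemiringExp semiring
    open SemiringMult semiring renaming (_×_ to _×#_)
    open SemiringSum semiring
    open RingProperties (CommutativeRing.ring A) using (+-inverseˡ-unique)
    open SetoidReasoning setoid

    p×≈0 : ∀ x → p ×# x ≈ 0#
    p×≈0 x = begin
      p ×# x          ≈⟨ ×-congʳ p (*-identityˡ x) ⟨
      p ×# (1# * x)   ≈⟨ ×-assoc-* p 1# x ⟨
      (p ×# 1#) * x   ≈⟨ *-congʳ char ⟩
      0# * x         ≈⟨ zeroˡ x ⟩
      0#             ∎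

    p∣m⇒m×≈0 : ∀ {m} → p ∣ m → ∀ x → m ×# x ≈ 0#
    p∣m⇒m×≈0 (divides q ≡.refl) x = begin
      (q ℕ.* p) ×# x  ≈⟨ ×-congˡ (ℕ.*-comm q p) ⟩
      (p ℕ.* q) ×# x  ≈⟨ ×-assocˡ x p q ⟨
      p ×# (q ×# x)    ≈⟨ p×≈0 (q ×# x) ⟩
      0#             ∎

    1^n≈1 : ∀ n → 1# ^ n ≈ 1#
    1^n≈1 zero = refl
    1^n≈1 (suc n) = trans (*-identityˡ _) (1^n≈1 n)

    private
      -- Exposing p as `suc m` lets the binomial sum split into its first term, m middle terms that
      -- vanish because p divides their coefficients, and its last term.
      frobenius-suc : ∀ {m} → p ≡ suc m → ∀ x y → (x + y) ^ p ≈ x ^ p + y ^ p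
      frobenius-suc {m} ≡.refl x y = begin
        (x + y) ^ p
          ≈⟨ Binomial.theorem commutativeSemiring p x y ⟩
        term zero + sum (λ k → term (suc k))
          ≈⟨ +-cong first (trans (sum-init-last (λ k → term (suc k))) (+-cong middle last)) ⟩
        y ^ p + (0# + x ^ p)
          ≈⟨ trans (+-congˡ (+-identityˡ _)) (+-comm _ _) ⟩
        x ^ p + y ^ p ∎
        where
        term : Fin (suc p) → Carrier
        term = Binomial.binomialTerm commutativeSemiring x y p
        first : term zero ≈ y ^ p
        first = trans (+-identityʳ _) (*-identityˡ _)
        middle : sum (λ i → term (suc (inject₁ i))) ≈ 0#
        middle = trans (sum-cong-≋ (λ i → p∣m⇒m×≈0 (p∣pCk p-prime (toℕ (inject₁ i))
            (ℕ.s≤s (≡.subst (ℕ._< m) (≡.sym (Fin.toℕ-inject₁ i)) (Fin.toℕ<n i))))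
            (Binomial.binomial commutativeSemiring x y p (suc (inject₁ i))))) (sum-replicate-zero m)
        last : term (suc (fromℕ m)) ≈ x ^ p
        last rewrite Fin.toℕ-fromℕ m | nCn≡1 p | ℕ.n∸n≡0 m = trans (+-identityʳ _) (*-identityʳ _)

    frobenius : ∀ x y → (x + y) ^ p ≈ x ^ p + y ^ p
    frobenius = frobenius-suc (≡.sym (ℕ.suc-pred p {{prime⇒nonZero p-prime}}))

    frobenius^ : ∀ d x y → (x + y) ^ (p ℕ.^ d) ≈ x ^ (p ℕ.^ d) + y ^ (p ℕ.^ d)
    frobenius^ zero x y = trans (*-identityʳ _) (+-cong (sym (*-identityʳ _)) (sym (*-identityʳ _)))
    frobenius^ (suc d) x y = begin
      (x + y) ^ (p ℕ.* p ℕ.^ d)                 ≈⟨ ^-assocʳ (x + y) p (p ℕ.^ d) ⟨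
      ((x + y) ^ p) ^ (p ℕ.^ d)                 ≈⟨ ^-congˡ (p ℕ.^ d) (frobenius x y) ⟩
      (x ^ p + y ^ p) ^ (p ℕ.^ d)               ≈⟨ frobenius^ d (x ^ p) (y ^ p) ⟩
      (x ^ p) ^ (p ℕ.^ d) + (y ^ p) ^ (p ℕ.^ d) ≈⟨ +-cong (^-assocʳ x p (p ℕ.^ d)) (^-assocʳ y p (p ℕ.^ d)) ⟩
      x ^ (p ℕ.* p ℕ.^ d) + y ^ (p ℕ.* p ℕ.^ d) ∎

    0^p^d≈0 : ∀ d → 0# ^ (p ℕ.^ d) ≈ 0#
    0^p^d≈0 d = 0^m (p ℕ.^ d) (ℕ.m^n≢0 p d {{prime⇒nonZero p-prime}})
      where
      0^m : ∀ m → ℕ.NonZero m → 0# ^ m ≈ 0#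
      0^m (suc m) _ = zeroˡ _

    -- Deduced from additivity rather than from the parity of the exponent, so that p = 2 is no
    -- special case.
    neg-^ : ∀ d x → (- x) ^ (p ℕ.^ d) ≈ - (x ^ (p ℕ.^ d))
    neg-^ d x = +-inverseˡ-unique _ _ (begin
      (- x) ^ (p ℕ.^ d) + x ^ (p ℕ.^ d)  ≈⟨ frobenius^ d (- x) x ⟨
      (- x + x) ^ (p ℕ.^ d)              ≈⟨ ^-congˡ (p ℕ.^ d) (-‿inverseˡ x) ⟩
      0# ^ (p ℕ.^ d)                     ≈⟨ 0^p^d≈0 d ⟩
      0#                                 ∎)

    -- Fermat's little theorem: additivity of Frobenius gives the induction on n.
    n×1-fixed : ∀ d n → (n ×# 1#) ^ (p ℕ.^ d) ≈ n ×# 1#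
    n×1-fixed d zero = 0^p^d≈0 d
    n×1-fixed d (suc n) = trans (frobenius^ d 1# (n ×# 1#)) (+-cong (1^n≈1 (p ℕ.^ d)) (n×1-fixed d n))

    sum-^ : ∀ d {n} (f : Fin n → Carrier) → sum f ^ (p ℕ.^ d) ≈ sum (λ i → f i ^ (p ℕ.^ d))
    sum-^ d {zero} f = 0^p^d≈0 d
    sum-^ d {suc n} f = trans (frobenius^ d (f zero) (sum (f ∘ suc))) (+-congˡ (sum-^ d (f ∘ suc)))

  -- Fields, polynomials and the number of roots

  record IsField (A : Ring) : Set where
    open CommutativeRing A
    field
      1≉0 : ¬ 1# ≈ 0#
      _≈?_ : ∀ x y → Dec (x ≈ y)
      invertible : ∀ x → ¬ x ≈ 0# → ∃ λ y → x * y ≈ 1#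

  module Polynomials (A : Ring) where
    open CommutativeRing A hiding (zero)
    open SemigroupProperties (CommutativeRing.+-commutativeSemigroup A) using (interchange)
    open SemigroupProperties (CommutativeRing.*-commutativeSemigroup A) using (x∙yz≈y∙xz)
    open RingProperties (CommutativeRing.ring A) using (-‿distribʳ-*; -‿+-comm)
    open SetoidReasoning setoid

    -- Horner's scheme, constant term first. A vector of length n stands for a polynomial of degree
    -- below n; leading coefficients may vanish, so the length plays the part of a degree bound.
    eval : ∀ {n} → Vec Carrier n → Carrier → Carrier
    eval [] x = 0#
    eval (a ∷ f) x = a + x * eval f x

    IsZero : ∀ {n} → Vec Carrier n → Set
    IsZero = All (_≈ 0#)

    -- Synthetic division by X - r: the coefficients of the quotient are the intermediate Horner
    -- values at r.
    divide : ∀ {n} → Vec Carrier (suc n) → Carrier → Vec Carrier n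
    divide (a ∷ []) r = []
    divide (a ∷ f@(_ ∷ _)) r = eval f r ∷ divide f r

    -- f(x) = f(r) + (x − r) g(x), arranged without subtraction
    divide-spec : ∀ {n} (f : Vec Carrier (suc n)) r x →
                  eval f x + r * eval (divide f r) x ≈ eval f r + x * eval (divide f r) x
    divide-spec (a ∷ []) r x = +-cong (+-congˡ (trans (zeroʳ x) (sym (zeroʳ r)))) (trans (zeroʳ r) (sym (zeroʳ x)))
    divide-spec (a ∷ f@(_ ∷ _)) r x = begin
      (a + x * eval f x) + r * (eval f r + x * Q)
        ≈⟨ lhs a x (eval f x) r (eval f r) Q ⟩
      (a + r * eval f r) + x * (eval f x + r * Q)
        ≈⟨ +-congˡ (*-congˡ (divide-spec f r x)) ⟩
      (a + r * eval f r) + x * (eval f r + x * Q) ∎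
      where
      Q = eval (divide f r) x
      lhs : ∀ a x u r v w → (a + x * u) + r * (v + x * w) ≈ (a + r * v) + x * (u + r * w)
      lhs a x u r v w = begin
        (a + x * u) + r * (v + x * w)        ≈⟨ +-congˡ (distribˡ r v (x * w)) ⟩
        (a + x * u) + (r * v + r * (x * w))  ≈⟨ interchange a (x * u) (r * v) (r * (x * w)) ⟩
        (a + r * v) + (x * u + r * (x * w))  ≈⟨ +-congˡ (+-congˡ (x∙yz≈y∙xz r x w)) ⟩
        (a + r * v) + (x * u + x * (r * w))  ≈⟨ +-congˡ (distribˡ x u (r * w)) ⟨
        (a + r * v) + x * (u + r * w)        ∎

    -- Since f = (X - r) g + f(r), a zero quotient g and a root at r leave nothing of f.
    divide-zero : ∀ {n} (f : Vec Carrier (suc n)) r → eval f r ≈ 0# → IsZero (divide f r) → IsZero f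
    divide-zero (a ∷ []) r f≈0 [] = trans (sym (trans (+-congˡ (zeroʳ r)) (+-identityʳ a))) f≈0 ∷ []
    divide-zero (a ∷ f@(_ ∷ _)) r f≈0 (fr≈0 ∷ rest) =
      trans (sym (trans (+-congˡ (trans (*-congˡ fr≈0) (zeroʳ r))) (+-identityʳ a))) f≈0 ∷ divide-zero f r fr≈0 rest

    _⊟_ : ∀ {n} → Vec Carrier n → Vec Carrier n → Vec Carrier n
    _⊟_ = zipWith (λ a b → a + - b)

    eval-⊟ : ∀ {n} (f g : Vec Carrier n) x → eval (f ⊟ g) x ≈ eval f x + - eval g x
    eval-⊟ [] [] x = sym (-‿inverseʳ 0#)
    eval-⊟ (a ∷ f) (b ∷ g) x = begin
      (a + - b) + x * eval (f ⊟ g) x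
        ≈⟨ +-congˡ (*-congˡ (eval-⊟ f g x)) ⟩
      (a + - b) + x * (eval f x + - eval g x)
        ≈⟨ regroup a (- b) x (eval f x) (- eval g x) ⟩
      (a + x * eval f x) + (- b + x * - eval g x)
        ≈⟨ +-congˡ (+-congˡ (sym (-‿distribʳ-* x (eval g x)))) ⟩
      (a + x * eval f x) + (- b + - (x * eval g x))
        ≈⟨ +-congˡ (-‿+-comm b (x * eval g x)) ⟩
      (a + x * eval f x) + - (b + x * eval g x) ∎
      where
      regroup : ∀ a b x u v → (a + b) + x * (u + v) ≈ (a + x * u) + (b + x * v)
      regroup a b x u v = trans (+-congˡ (distribˡ x u v)) (interchange a b (x * u) (x * v))

  module FieldProperties (A : Ring) (A-field : IsField A) where
    open CommutativeRing A hiding (zero)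
    open IsField A-field
    open Polynomials A
    open RingProperties (CommutativeRing.ring A) using (-‿distribˡ-*)
    open GroupProperties +-group using () renaming (x∙y⁻¹≈ε⇒x≈y to x-y≈0⇒x≈y) public
    open SetoidReasoning setoid

    no-zero-divisors : ∀ {x y} → x * y ≈ 0# → ¬ x ≈ 0# → y ≈ 0#
    no-zero-divisors {x} {y} xy≈0 x≉0 with invertible x x≉0
    ... | z , xz≈1 = begin
      y            ≈⟨ *-identityˡ y ⟨
      1# * y       ≈⟨ *-congʳ (trans (sym xz≈1) (*-comm x z)) ⟩
      (z * x) * y  ≈⟨ *-assoc z x y ⟩
      z * (x * y)  ≈⟨ trans (*-congˡ xy≈0) (zeroʳ z) ⟩
      0#           ∎

    ≉⇒difference≉0 : ∀ {x y} → ¬ x ≈ y → ¬ x + - y ≈ 0#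
    ≉⇒difference≉0 {x} {y} x≉y d≈0 = x≉y (x-y≈0⇒x≈y x y d≈0)

    *-cancel-zero : ∀ {x y z} → x * z ≈ y * z → ¬ x ≈ y → z ≈ 0#
    *-cancel-zero {x} {y} {z} xz≈yz x≉y = no-zero-divisors (begin
      (x + - y) * z        ≈⟨ distribʳ z x (- y) ⟩
      x * z + (- y) * z    ≈⟨ +-cong xz≈yz (sym (-‿distribˡ-* y z)) ⟩
      y * z + - (y * z)    ≈⟨ -‿inverseʳ (y * z) ⟩
      0#                   ∎) (≉⇒difference≉0 x≉y)

    Distinct : ∀ {n} → (Fin n → Carrier) → Set
    Distinct xs = ∀ i j → i ≢ j → ¬ xs i ≈ xs j

    -- Dividing by X - r for the first root r removes one coefficient. At any other root x,
    -- `divide-spec` reads r g(x) = x g(x), and x ≠ r makes x a root of the quotient g.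
    root-bound : ∀ {n} (f : Vec Carrier n) (xs : Fin n → Carrier) → Distinct xs →
                 (∀ i → eval f (xs i) ≈ 0#) → IsZero f
    root-bound {zero} [] xs distinct roots = []
    root-bound {suc n} f xs distinct roots = divide-zero f r (roots zero)
      (root-bound (divide f r) (xs ∘ suc) (λ i j i≢j → distinct (suc i) (suc j) (i≢j ∘ Fin.suc-injective))
        (λ i → *-cancel-zero (begin
          r * Q i                              ≈⟨ +-identityˡ _ ⟨
          0# + r * Q i                         ≈⟨ +-congʳ (roots (suc i)) ⟨
          eval f (xs (suc i)) + r * Q i        ≈⟨ divide-spec f r (xs (suc i)) ⟩
          eval f r + xs (suc i) * Q i          ≈⟨ +-congʳ (roots zero) ⟩
          0# + xs (suc i) * Q i                ≈⟨ +-identityˡ _ ⟩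
          xs (suc i) * Q i                     ∎) (distinct zero (suc i) λ ())))
      where
      r = xs zero
      Q : Fin n → Carrier
      Q i = eval (divide f r) (xs (suc i))

  record FiniteField (q : ℕ) : Set₁ where
    field
      ring : Ring
      isField : IsField ring
    open CommutativeRing ring using (Carrier; _≈_)
    field
      enumerate : Fin q → Carrier
      enumerate-injective : ∀ i j → enumerate i ≈ enumerate j → i ≡ j
      enumerate-surjective : ∀ y → ∃ λ i → enumerate i ≈ y

  -- Fields of characteristic p in which y^q = y

  module PrimePowerOrder (A : Ring) (A-field : IsField A) {p : ℕ} (p-prime : Prime p)
    (char : CommutativeRing._≈_ A (SemiringMult._×_ (CommutativeRing.semiring A) p (CommutativeRing.1# A)) (CommutativeRing.0# A)) where
    open CommutativeRing A hiding (zero)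
    open IsField A-field
    open FieldProperties A A-field
    open Polynomials A
    open Characteristic A p-prime char
    open SemiringExp semiring
    open CommutativeSemiringExp commutativeSemiring using (^-distrib-*)
    open SemiringMult semiring renaming (_×_ to _×#_)
    open RingProperties (CommutativeRing.ring A) using (+-cancelˡ)
    open SetoidReasoning setoid

    -- Bézout expresses 1 through multiples of m and p; if both vanished in the field, so would 1.
    -- The two cases are the two signs of the Bézout identity over ℕ.
    coprime-×≉0 : ∀ m → Coprime m p → ¬ m ×# 1# ≈ 0#
    coprime-×≉0 m coprime m≈0 with coprime-Bézout coprime
    ... | GCD.Bézout.+- x y eq = 1≉0 (trans (sym (+-identityʳ 1#)) (begin
      1# + 0#                  ≈⟨ +-congˡ (trans (*-congˡ char) (zeroʳ (y ×# 1#))) ⟨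
      1# + (y ×# 1#) * (p ×# 1#) ≈⟨ +-congˡ (×1-homo-* y p) ⟨
      (1 ℕ.+ y ℕ.* p) ×# 1#    ≈⟨ ×-congˡ eq ⟩
      (x ℕ.* m) ×# 1#          ≈⟨ ×1-homo-* x m ⟩
      (x ×# 1#) * (m ×# 1#)    ≈⟨ trans (*-congˡ m≈0) (zeroʳ _) ⟩
      0#                       ∎))
    ... | GCD.Bézout.-+ x y eq = 1≉0 (trans (sym (+-identityʳ 1#)) (begin
      1# + 0#                  ≈⟨ +-congˡ (trans (*-congˡ m≈0) (zeroʳ (x ×# 1#))) ⟨
      1# + (x ×# 1#) * (m ×# 1#) ≈⟨ +-congˡ (×1-homo-* x m) ⟨
      (1 ℕ.+ x ℕ.* m) ×# 1#    ≈⟨ ×-congˡ eq ⟩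
      (y ℕ.* p) ×# 1#          ≈⟨ ×1-homo-* y p ⟩
      (y ×# 1#) * (p ×# 1#)    ≈⟨ trans (*-congˡ char) (zeroʳ _) ⟩
      0#                       ∎))

    ×1-injective-< : ∀ {m n} → m ℕ.< n → n ℕ.< p → ¬ m ×# 1# ≈ n ×# 1#
    ×1-injective-< {m} {n} m<n n<p eq = coprime-×≉0 (n ℕ.∸ m)
      (Coprimality.sym (prime⇒coprime p-prime {{ℕ.≢-nonZero (ℕ.m<n⇒n≢0 (ℕ.m<n⇒0<n∸m m<n))}}
        (ℕ.≤-<-trans (ℕ.m∸n≤m n m) n<p)))
      (+-cancelˡ (m ×# 1#) ((n ℕ.∸ m) ×# 1#) 0# (begin
        m ×# 1# + (n ℕ.∸ m) ×# 1#  ≈⟨ ×-homo-+ 1# m (n ℕ.∸ m) ⟨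
        (m ℕ.+ (n ℕ.∸ m)) ×# 1#    ≈⟨ ×-congˡ (ℕ.m+[n∸m]≡n (ℕ.<⇒≤ m<n)) ⟩
        n ×# 1#                    ≈⟨ eq ⟨
        m ×# 1#                    ≈⟨ +-identityʳ _ ⟨
        m ×# 1# + 0#               ∎))

    ×1-injective : ∀ (i j : Fin p) → toℕ i ×# 1# ≈ toℕ j ×# 1# → i ≡ j
    ×1-injective i j eq with ℕ.<-cmp (toℕ i) (toℕ j)
    ... | tri< i<j _ _ = contradiction eq (×1-injective-< i<j (Fin.toℕ<n j))
    ... | tri≈ _ i≡j _ = Fin.toℕ-injective i≡j
    ... | tri> _ _ j<i = contradiction (sym eq) (×1-injective-< j<i (Fin.toℕ<n i))

    -- Base-p digits, most significant first, read as coefficients in the prime field: the index i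
    -- runs through all polynomials of degree below m over it.
    digits : ∀ m → Fin (p ℕ.^ m) → Vec Carrier m
    digits zero i = []
    digits (suc m) i = (toℕ (proj₁ (remQuot {p} (p ℕ.^ m) i)) ×# 1#) ∷ digits m (proj₂ (remQuot {p} (p ℕ.^ m) i))

    digits-injective : ∀ m i j → IsZero (digits m i ⊟ digits m j) → i ≡ j
    digits-injective zero zero zero _ = ≡.refl
    digits-injective (suc m) i j (d ∷ ds) = ≡.trans (≡.sym (Fin.combine-remQuot {p} (p ℕ.^ m) i))
      (≡.trans (cong₂ combine (×1-injective _ _ (x-y≈0⇒x≈y _ _ d)) (digits-injective m _ _ ds))
        (Fin.combine-remQuot {p} (p ℕ.^ m) j))

    digits-fixed : ∀ d m i j → All (λ a → a ^ (p ℕ.^ d) ≈ a) (digits m i ⊟ digits m j)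
    digits-fixed d zero i j = []
    digits-fixed d (suc m) i j =
      trans (frobenius^ d _ _) (+-cong (n×1-fixed d (lead i)) (trans (neg-^ d _) (-‿cong (n×1-fixed d (lead j)))))
        ∷ digits-fixed d m _ _
      where
      lead : Fin (p ℕ.^ suc m) → ℕ
      lead k = toℕ (proj₁ (remQuot {p} (p ℕ.^ m) k))

    -- Frobenius is a ring homomorphism fixing the coefficients, so it commutes with f. This is what
    -- carries a root of f to all its conjugates.
    eval-fixed : ∀ d {n} {f : Vec Carrier n} → All (λ a → a ^ (p ℕ.^ d) ≈ a) f →
                 ∀ x → eval f (x ^ (p ℕ.^ d)) ≈ eval f x ^ (p ℕ.^ d)
    eval-fixed d [] x = sym (0^p^d≈0 d)
    eval-fixed d {f = a ∷ f} (a-fixed ∷ fixed) x = begin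
      a + x ^ Q * eval f (x ^ Q)        ≈⟨ +-cong (sym a-fixed) (*-congˡ (eval-fixed d fixed x)) ⟩
      a ^ Q + x ^ Q * eval f x ^ Q      ≈⟨ +-congˡ (^-distrib-* x (eval f x) Q) ⟨
      a ^ Q + (x * eval f x) ^ Q        ≈⟨ frobenius^ d a (x * eval f x) ⟨
      (a + x * eval f x) ^ Q            ∎
      where Q = p ℕ.^ d

    monomial : ∀ m → Vec Carrier (suc m)
    monomial zero = 1# ∷ []
    monomial (suc m) = 0# ∷ monomial m

    eval-monomial : ∀ m x → eval (monomial m) x ≈ x ^ m
    eval-monomial zero x = trans (+-congˡ (zeroʳ x)) (+-identityʳ 1#)
    eval-monomial (suc m) x = trans (+-identityˡ _) (*-congˡ (eval-monomial m x))

    at-most-q-fixed : ∀ {q} → 2 ℕ.≤ q → (∀ x → x ^ q ≈ x) → (xs : Fin (suc q) → Carrier) → ¬ Distinct xs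
    at-most-q-fixed {suc (suc m)} (ℕ.s≤s (ℕ.s≤s _)) fixed xs distinct =
      1≉0 (nonzero (root-bound f xs distinct (λ i → root (xs i))))
      where
      -- With q = m + 2 this is X^q - X, which has q + 1 coefficients. As q ≥ 2, the coefficient -1
      -- of X stands apart from the leading 1, and its nonvanishing gives the contradiction.
      f : Vec Carrier (suc (suc (suc m)))
      f = 0# ∷ - 1# ∷ monomial m
      root : ∀ x → eval f x ≈ 0#
      root x = begin
        0# + x * (- 1# + x * eval (monomial m) x)  ≈⟨ +-identityˡ _ ⟩
        x * (- 1# + x * eval (monomial m) x)       ≈⟨ *-congˡ (+-congˡ (*-congˡ (eval-monomial m x))) ⟩
        x * (- 1# + x * x ^ m)                     ≈⟨ distribˡ x (- 1#) (x * x ^ m) ⟩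
        x * - 1# + x ^ suc (suc m)                 ≈⟨ +-congˡ (trans (fixed x) (sym (*-identityʳ x))) ⟩
        x * - 1# + x * 1#                          ≈⟨ distribˡ x (- 1#) 1# ⟨
        x * (- 1# + 1#)                            ≈⟨ trans (*-congˡ (-‿inverseˡ 1#)) (zeroʳ x) ⟩
        0#                                         ∎
      nonzero : IsZero f → 1# ≈ 0#
      nonzero (_ ∷ -1≈0 ∷ _) = trans (sym (+-identityˡ 1#)) (trans (+-congʳ (sym -1≈0)) (-‿inverseˡ 1#))

    module _ (h : ℕ) (fixed : ∀ x → x ^ (p ℕ.^ h) ≈ x)
             (α : Carrier) (α-moved : ∀ d → 1 ℕ.≤ d → d ℕ.< h → ¬ α ^ (p ℕ.^ d) ≈ α) where

      conjugate : Fin h → Carrier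
      conjugate i = α ^ (p ℕ.^ toℕ i)

      -- α^(p^i) = α^(p^j) raised to the power p^(h−i) gives α = α^(p^(j−i)).
      conjugates-distinct-< : ∀ i j → toℕ i ℕ.< toℕ j → ¬ conjugate i ≈ conjugate j
      conjugates-distinct-< i j i<j eq = α-moved (b ℕ.∸ a) (ℕ.m<n⇒0<n∸m i<j) (ℕ.≤-<-trans (ℕ.m∸n≤m b a) (Fin.toℕ<n j))
        (sym (begin
          α                                    ≈⟨ fixed α ⟨
          α ^ (p ℕ.^ h)                        ≈⟨ ^-congʳ α (cong (p ℕ.^_) (ℕ.m+[n∸m]≡n (ℕ.<⇒≤ (Fin.toℕ<n i)))) ⟨
          α ^ (p ℕ.^ (a ℕ.+ (h ℕ.∸ a)))        ≈⟨ power a (h ℕ.∸ a) ⟩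
          (α ^ (p ℕ.^ a)) ^ (p ℕ.^ (h ℕ.∸ a))  ≈⟨ ^-congˡ (p ℕ.^ (h ℕ.∸ a)) eq ⟩
          (α ^ (p ℕ.^ b)) ^ (p ℕ.^ (h ℕ.∸ a))  ≈⟨ power b (h ℕ.∸ a) ⟨
          α ^ (p ℕ.^ (b ℕ.+ (h ℕ.∸ a)))        ≈⟨ ^-congʳ α (cong (p ℕ.^_) exponents) ⟩
          α ^ (p ℕ.^ ((b ℕ.∸ a) ℕ.+ h))        ≈⟨ power (b ℕ.∸ a) h ⟩
          (α ^ (p ℕ.^ (b ℕ.∸ a))) ^ (p ℕ.^ h)  ≈⟨ fixed _ ⟩
          α ^ (p ℕ.^ (b ℕ.∸ a))                ∎))
        where
        a = toℕ i
        b = toℕ j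
        power : ∀ m n → α ^ (p ℕ.^ (m ℕ.+ n)) ≈ (α ^ (p ℕ.^ m)) ^ (p ℕ.^ n)
        power m n = trans (^-congʳ α (ℕ.^-distribˡ-+-* p m n)) (sym (^-assocʳ α (p ℕ.^ m) (p ℕ.^ n)))
        exponents : b ℕ.+ (h ℕ.∸ a) ≡ (b ℕ.∸ a) ℕ.+ h
        exponents = ≡.trans (≡.sym (ℕ.+-∸-assoc b (ℕ.<⇒≤ (Fin.toℕ<n i))))
          (≡.trans (cong (ℕ._∸ a) (ℕ.+-comm b h)) (≡.trans (ℕ.+-∸-assoc h (ℕ.<⇒≤ i<j)) (ℕ.+-comm h (b ℕ.∸ a))))

      conjugates-distinct : Distinct conjugate
      conjugates-distinct i j i≢j with ℕ.<-cmp (toℕ i) (toℕ j)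
      ... | tri< i<j _ _ = conjugates-distinct-< i j i<j
      ... | tri≈ _ i≡j _ = contradiction (Fin.toℕ-injective i≡j) i≢j
      ... | tri> _ _ j<i = conjugates-distinct-< j i j<i ∘ sym

      element : Fin (p ℕ.^ h) → Carrier
      element i = eval (digits h i) α

      -- The difference of two digit vectors has h coefficients. Vanishing at α, it vanishes at the
      -- h distinct conjugates of α, hence identically.
      element-injective : ∀ i j → element i ≈ element j → i ≡ j
      element-injective i j eq = digits-injective h i j (root-bound f conjugate conjugates-distinct (λ k → begin
        eval f (conjugate k)             ≈⟨ eval-fixed (toℕ k) (digits-fixed (toℕ k) h i j) α ⟩
        eval f α ^ (p ℕ.^ toℕ k)         ≈⟨ ^-congˡ (p ℕ.^ toℕ k) root ⟩
        0# ^ (p ℕ.^ toℕ k)               ≈⟨ 0^p^d≈0 (toℕ k) ⟩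
        0#                               ∎))
        where
        f = digits h i ⊟ digits h j
        root : eval f α ≈ 0#
        root = trans (eval-⊟ (digits h i) (digits h j) α) (trans (+-congʳ eq) (-‿inverseʳ _))

      finiteField : 2 ℕ.≤ p ℕ.^ h → FiniteField (p ℕ.^ h)
      finiteField 2≤q = record
        { ring = A ; isField = A-field
        ; enumerate = element
        ; enumerate-injective = element-injective
        ; enumerate-surjective = surjective }
        where
        surjective : ∀ y → ∃ λ i → element i ≈ y
        surjective y with Fin.any? (λ i → element i ≈? y)
        ... | yes found = found
        -- A missed y together with the q listed elements would be q + 1 distinct solutions of y^q =
        -- y.
        ... | no missed = contradiction distinct (at-most-q-fixed 2≤q fixed xs)
          where
          xs : Fin (suc (p ℕ.^ h)) → Carrier
          xs zero = y
          xs (suc i) = element i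
          distinct : Distinct xs
          distinct zero zero 0≢0 _ = 0≢0 ≡.refl
          distinct zero (suc j) _ eq = missed (j , sym eq)
          distinct (suc i) zero _ eq = missed (i , eq)
          distinct (suc i) (suc j) i≢j eq = i≢j (cong suc (element-injective i j eq))

  -- The prime field as a quotient of the integers

  module IntegersMod (p : ℕ) (p-prime : Prime p) where

    infix 4 _≡ₚ_
    -- A record, so that x and y can be inferred from the type x ≡ₚ y.
    record _≡ₚ_ (x y : ℤ) : Set where
      constructor mod
      field
        difference : pos p ℤ.∣ (x ℤ.- y)
    open _≡ₚ_

    congruence : Congruence ℤ.+-*-commutativeRing
    congruence = record
      { _∼_ = _≡ₚ_
      ; ∼-equiv = record
        { refl = λ {x} → ≡⇒∼ {x} ≡.refl
        ; sym = λ {x} {y} (mod d) → mod (≡.subst (pos p ℤ.∣_) (flip x y) (ℤ.∣n⇒∣m*n (ℤ.- pos 1) d))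
        ; trans = λ {x} {y} {z} (mod d) (mod e) → mod (≡.subst (pos p ℤ.∣_) (telescope x y z) (ℤ.∣m∣n⇒∣m+n d e)) }
      ; ≈⇒∼ = ≡⇒∼
      ; +-cong∼ = λ {x} {y} {u} {v} (mod d) (mod e) → mod (≡.subst (pos p ℤ.∣_) (sums x y u v) (ℤ.∣m∣n⇒∣m+n d e))
      ; *-cong∼ = λ {x} {y} {u} {v} (mod d) (mod e) → mod (≡.subst (pos p ℤ.∣_) (products x y u v)
          (ℤ.∣m∣n⇒∣m+n (ℤ.∣n⇒∣m*n u d) (ℤ.∣n⇒∣m*n y e)))
      ; neg-cong∼ = λ {x} {y} (mod d) → mod (≡.subst (pos p ℤ.∣_) (negate x y) (ℤ.∣n⇒∣m*n (ℤ.- pos 1) d)) }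
      where
      ≡⇒∼ : ∀ {x y} → x ≡ y → x ≡ₚ y
      ≡⇒∼ {x} ≡.refl = mod (ℤ.divides (pos 0) (ℤ.+-inverseʳ x))
      flip : ∀ x y → ℤ.- pos 1 ℤ.* (x ℤ.- y) ≡ y ℤ.- x
      flip = ℤ-solve-∀
      telescope : ∀ x y z → (x ℤ.- y) ℤ.+ (y ℤ.- z) ≡ x ℤ.- z
      telescope = ℤ-solve-∀
      sums : ∀ x y u v → (x ℤ.- y) ℤ.+ (u ℤ.- v) ≡ (x ℤ.+ u) ℤ.- (y ℤ.+ v)
      sums = ℤ-solve-∀
      products : ∀ x y u v → u ℤ.* (x ℤ.- y) ℤ.+ y ℤ.* (u ℤ.- v) ≡ x ℤ.* u ℤ.- y ℤ.* v
      products = ℤ-solve-∀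
      negate : ∀ x y → ℤ.- pos 1 ℤ.* (x ℤ.- y) ≡ ℤ.- x ℤ.- ℤ.- y
      negate = ℤ-solve-∀

    ℤ/p : Ring
    ℤ/p = quotient ℤ.+-*-commutativeRing congruence

    open CommutativeRing ℤ/p hiding (zero; _+_; _*_)
    open SemiringMult semiring renaming (_×_ to _×#_)
    open SemiringExp semiring using (_^_)

    _≈?_ : ∀ x y → Dec (x ≈ y)
    x ≈? y = map′ mod difference (pos p ℤ.∣? (x ℤ.- y))

    n×1≡n : ∀ n → n ×# 1# ≡ pos n
    n×1≡n zero = ≡.refl
    n×1≡n (suc n) = cong (ℤ._+_ (pos 1)) (n×1≡n n)

    char : p ×# 1# ≈ 0#
    char = ≡.subst (_≈ 0#) (≡.sym (n×1≡n p))
      (mod (ℤ.divides (pos 1) (≡.trans (ℤ.+-identityʳ (pos p)) (≡.sym (ℤ.*-identityˡ (pos p))))))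

    1≉0 : ¬ 1# ≈ 0#
    1≉0 (mod p∣1) = ℕ.nonTrivial⇒≢1 {{prime⇒nonTrivial p-prime}} (∣1⇒≡1 (ℤ.∣⇒∣ᵤ p∣1))

    open Characteristic ℤ/p p-prime char using (n×1-fixed; neg-^)

    fixed : ∀ d c → c ^ (p ℕ.^ d) ≈ c
    fixed d (pos n) = ≡.subst (λ c → c ^ (p ℕ.^ d) ≈ c) (n×1≡n n) (n×1-fixed d n)
    fixed d -[1+ n ] = trans (neg-^ d (pos (suc n))) (-‿cong (fixed d (pos (suc n))))

    -- The carrier is all of ℤ, so finiteness of the quotient takes the form of a list meeting every
    -- residue class.
    residues : List ℤ
    residues = map pos (upTo p)

    residues-complete : ∀ c → Any (c ≈_) residues
    residues-complete c = Any.map⁺ (Any.map (λ {r} r≡ → ≡.subst (λ r → c ≈ pos r) r≡ c≈r)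
      (Membership.∈-upTo⁺ (ℤ.n%ℕd<d c p)))
      where
      instance
        p≢0 : ℕ.NonZero p
        p≢0 = prime⇒nonZero p-prime
      c≈r : c ≈ pos (c ℤ.%ℕ p)
      c≈r = mod (ℤ.divides (c ℤ./ℕ p) (≡.trans (cong (ℤ._- pos (c ℤ.%ℕ p)) (ℤ.a≡a%ℕn+[a/ℕn]*n c p))
        (cancel (pos (c ℤ.%ℕ p)) (c ℤ./ℕ p ℤ.* pos p))))
        where
        cancel : ∀ a b → a ℤ.+ b ℤ.- a ≡ b
        cancel = ℤ-solve-∀

  -- The cyclic group of residues modulo N

  module Cyclic (N′ : ℕ) where
    private N = suc N′

    red : ℕ → Fin N
    red m = fromℕ< (ℕ.m%n<n m N)

    infixl 6 _⊕_
    _⊕_ : Fin N → Fin N → Fin N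
    i ⊕ j = red (toℕ i ℕ.+ toℕ j)

    toℕ-red : ∀ m → toℕ (red m) ≡ m ℕ.% N
    toℕ-red m = Fin.toℕ-fromℕ< (ℕ.m%n<n m N)

    red-cong : ∀ {a b} → a ℕ.% N ≡ b ℕ.% N → red a ≡ red b
    red-cong {a} {b} eq = Fin.toℕ-injective (≡.trans (toℕ-red a) (≡.trans eq (≡.sym (toℕ-red b))))

    toℕ-red-< : ∀ {m} → m ℕ.< N → toℕ (red m) ≡ m
    toℕ-red-< {m} m<N = ≡.trans (toℕ-red m) (ℕ.m<n⇒m%n≡m m<N)

    red-toℕ : ∀ i → red (toℕ i) ≡ i
    red-toℕ i = Fin.toℕ-injective (toℕ-red-< (Fin.toℕ<n i))

    red-⊕ : ∀ a b → red a ⊕ red b ≡ red (a ℕ.+ b)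
    red-⊕ a b = ≡.trans (cong₂ (λ x y → red (x ℕ.+ y)) (toℕ-red a) (toℕ-red b))
      (red-cong {a ℕ.% N ℕ.+ b ℕ.% N} {a ℕ.+ b} (≡.sym (ℕ.%-distribˡ-+ a b N)))

    ⊕-comm : ∀ i j → i ⊕ j ≡ j ⊕ i
    ⊕-comm i j = cong red (ℕ.+-comm (toℕ i) (toℕ j))

    ⊕-assoc : ∀ i j k → (i ⊕ j) ⊕ k ≡ i ⊕ (j ⊕ k)
    ⊕-assoc i j k = begin
      red (toℕ i ℕ.+ toℕ j) ⊕ k              ≡⟨ cong ((i ⊕ j) ⊕_) (red-toℕ k) ⟨
      red (toℕ i ℕ.+ toℕ j) ⊕ red (toℕ k)    ≡⟨ red-⊕ (toℕ i ℕ.+ toℕ j) (toℕ k) ⟩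
      red (toℕ i ℕ.+ toℕ j ℕ.+ toℕ k)        ≡⟨ cong red (ℕ.+-assoc (toℕ i) (toℕ j) (toℕ k)) ⟩
      red (toℕ i ℕ.+ (toℕ j ℕ.+ toℕ k))      ≡⟨ red-⊕ (toℕ i) (toℕ j ℕ.+ toℕ k) ⟨
      red (toℕ i) ⊕ (j ⊕ k)                  ≡⟨ cong (_⊕ (j ⊕ k)) (red-toℕ i) ⟩
      i ⊕ (j ⊕ k)                            ∎
      where open ≡.≡-Reasoning

    ⊕-identityˡ : ∀ i → zero ⊕ i ≡ i
    ⊕-identityˡ = red-toℕ

    -- Adding a N′ undoes adding a, because a N′ + a = a N vanishes modulo N.
    red-⊕-cancel : ∀ a i j → red a ⊕ i ≡ red a ⊕ j → i ≡ j
    red-⊕-cancel a i j eq = ≡.trans (≡.sym (undo i)) (≡.trans (cong (red (a ℕ.* N′) ⊕_) eq) (undo j))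
      where
      undo : ∀ k → red (a ℕ.* N′) ⊕ (red a ⊕ k) ≡ k
      undo k = ≡.trans (≡.sym (⊕-assoc (red (a ℕ.* N′)) (red a) k)) (≡.trans (cong (_⊕ k) (≡.trans (red-⊕ (a ℕ.* N′) a)
        (red-cong {a ℕ.* N′ ℕ.+ a} {0} (≡.trans
          (cong (ℕ._% N) (≡.trans (ℕ.+-comm (a ℕ.* N′) a) (≡.sym (ℕ.*-suc a N′)))) (ℕ.m*n%n≡0 a N)))))
        (⊕-identityˡ k))

  -- Cutting a field out of a finite ring by an idempotent

  module PrimitiveIdempotent (R : Ring) (N′ : ℕ)
    (_≈?_ : ∀ x y → Dec (CommutativeRing._≈_ R x y))
    (fixed : ∀ x → CommutativeRing._≈_ R (SemiringExp._^_ (CommutativeRing.semiring R) x (suc (suc N′))) x) where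
    open CommutativeRing R hiding (zero)
    open SemiringExp semiring
    open SemigroupProperties (CommutativeRing.*-commutativeSemigroup R) using (interchange; x∙yz≈y∙xz; xy∙z≈xz∙y)
    open SetoidReasoning setoid
    private N = suc N′

    -- One factor y moves across: y^N y^N = y^(N+1) y^(N-1), and y^(N+1) = y.
    y^N-idempotent : ∀ y → y ^ N * y ^ N ≈ y ^ N
    y^N-idempotent y = begin
      (y * y ^ N′) * y ^ N    ≈⟨ xy∙z≈xz∙y y (y ^ N′) (y ^ N) ⟩
      (y * y ^ N) * y ^ N′    ≈⟨ *-congʳ (fixed y) ⟩
      y * y ^ N′              ∎

    -- Modulo the ideal generated by 1 - e, the alternatives say that y is zero, or that y^N = 1 and
    -- so y^(N-1) is an inverse of y. Deciding every y thus amounts to the field axiom.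
    Decided : Carrier → Carrier → Set
    Decided e y = e * y ≈ 0# ⊎ e * y ^ N ≈ e

    record Refinement (e : Carrier) (ys : List Carrier) : Set where
      field
        e′ : Carrier
        idempotent : e′ * e′ ≈ e′
        nonzero : ¬ e′ ≈ 0#
        below : e′ * e ≈ e′
        decided : ListAll.All (Decided e′) ys

    -- Unless e y = 0, replace e by e y ^ N; both alternatives in Decided are inherited by the
    -- idempotents below e, so one pass through ys is enough.
    refine : ∀ e → e * e ≈ e → ¬ e ≈ 0# → ∀ ys → Refinement e ys
    refine e ee≈e e≉0 [] = record { e′ = e ; idempotent = ee≈e ; nonzero = e≉0 ; below = ee≈e ; decided = [] }
    refine e ee≈e e≉0 (y ∷ ys) = step ((e * y) ≈? 0#)
      where
      step : Dec (e * y ≈ 0#) → Refinement e (y ∷ ys)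
      step (yes ey≈0) = record
        { e′ = e′ ; idempotent = idempotent ; nonzero = nonzero ; below = below
        ; decided = inj₁ (begin
            e′ * y         ≈⟨ *-congʳ below ⟨
            (e′ * e) * y   ≈⟨ *-assoc e′ e y ⟩
            e′ * (e * y)   ≈⟨ trans (*-congˡ ey≈0) (zeroʳ e′) ⟩
            0#             ∎) ∷ decided }
        where open Refinement (refine e ee≈e e≉0 ys)
      step (no ey≉0) = record
        { e′ = e′ ; idempotent = idempotent ; nonzero = nonzero
        ; below = begin
            e′ * e             ≈⟨ *-congʳ below ⟨
            (e′ * e₁) * e      ≈⟨ *-assoc e′ e₁ e ⟩
            e′ * (e₁ * e)      ≈⟨ *-congˡ (trans (*-comm e₁ e) (trans (sym (*-assoc e e (y ^ N))) (*-congʳ ee≈e))) ⟩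
            e′ * e₁            ≈⟨ below ⟩
            e′                 ∎
        ; decided = inj₂ (begin
            e′ * y ^ N               ≈⟨ *-congʳ below ⟨
            (e′ * e₁) * y ^ N        ≈⟨ *-assoc e′ e₁ (y ^ N) ⟩
            e′ * (e₁ * y ^ N)        ≈⟨ *-congˡ (trans (*-assoc e (y ^ N) (y ^ N)) (*-congˡ (y^N-idempotent y))) ⟩
            e′ * e₁                  ≈⟨ below ⟩
            e′                       ∎) ∷ decided }
        where
        e₁ = e * y ^ N
        e₁-idempotent : e₁ * e₁ ≈ e₁
        e₁-idempotent = trans (interchange e (y ^ N) e (y ^ N)) (*-cong ee≈e (y^N-idempotent y))
        -- From y = y y^N follows e y = y e₁, so e₁ can vanish only together with e y.
        e₁≉0 : ¬ e₁ ≈ 0#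
        e₁≉0 e₁≈0 = ey≉0 (begin
          e * y             ≈⟨ *-congˡ (fixed y) ⟨
          e * (y * y ^ N)   ≈⟨ x∙yz≈y∙xz e y (y ^ N) ⟩
          y * e₁            ≈⟨ trans (*-congˡ e₁≈0) (zeroʳ y) ⟩
          0#                ∎)
        open Refinement (refine e₁ e₁-idempotent e₁≉0 ys)

    -- Congruence modulo the ideal (1 − e).
    record EqualOn (e x y : Carrier) : Set where
      constructor on
      field
        equal : e * x ≈ e * y
    open EqualOn

    localise : Carrier → Congruence R
    localise e = record
      { _∼_ = EqualOn e
      ; ∼-equiv = record
        { refl = on refl ; sym = λ (on p) → on (sym p) ; trans = λ (on p) (on r) → on (trans p r) }
      ; ≈⇒∼ = λ p → on (*-congˡ p)
      ; +-cong∼ = λ {x} {y} {u} {v} (on p) (on r) → on (trans (distribˡ e x u) (trans (+-cong p r) (sym (distribˡ e y v))))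
      ; *-cong∼ = λ {x} {y} {u} {v} (on p) (on r) → on (begin
          e * (x * u)   ≈⟨ *-assoc e x u ⟨
          (e * x) * u   ≈⟨ *-congʳ p ⟩
          (e * y) * u   ≈⟨ trans (*-assoc e y u) (x∙yz≈y∙xz e y u) ⟩
          y * (e * u)   ≈⟨ *-congˡ r ⟩
          y * (e * v)   ≈⟨ x∙yz≈y∙xz y e v ⟩
          e * (y * v)   ∎)
      ; neg-cong∼ = λ {x} {y} (on p) → on (trans (sym (-‿distribʳ-* e x)) (trans (-‿cong p) (-‿distribʳ-* e y))) }
      where open RingProperties (CommutativeRing.ring R) using (-‿distribʳ-*)

    localise-field : ∀ e → ¬ e ≈ 0# → (∀ y → Decided e y) → IsField (quotient R (localise e))
    localise-field e e≉0 decided = record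
      { 1≉0 = λ (on e1≈e0) → e≉0 (trans (sym (*-identityʳ e)) (trans e1≈e0 (zeroʳ e)))
      ; _≈?_ = λ x y → map′ on equal ((e * x) ≈? (e * y))
      ; invertible = λ x x≉0 → x ^ N′ , inverse x x≉0 (decided x) }
      where
      inverse : ∀ x → ¬ EqualOn e x 0# → Decided e x → EqualOn e (x * x ^ N′) 1#
      inverse x x≉0 (inj₁ ex≈0) = contradiction (on (trans ex≈0 (sym (zeroʳ e)))) x≉0
      inverse x x≉0 (inj₂ ex^N≈e) = on (trans ex^N≈e (sym (*-identityʳ e)))

  functions : ∀ {C : Set} → List C → ∀ n → List (Fin n → C)
  functions cs zero = (λ ()) ∷ []
  functions cs (suc n) = cartesianProductWith Vector._∷_ cs (functions cs n)

  -- Pointwise agreement up to `_~_` is the equality of the group algebra, so with residues as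
  -- values this lists all elements of that algebra.
  functions-complete : ∀ {C : Set} (_~_ : C → C → Set) (cs : List C) → (∀ c → Any (c ~_) cs) →
                       ∀ n (f : Fin n → C) → Any (λ g → ∀ i → f i ~ g i) (functions cs n)
  functions-complete _~_ cs complete zero f = here λ ()
  functions-complete {C} _~_ cs complete (suc n) f =
    Any.cartesianProductWith⁺ Vector._∷_ prepend (complete (f zero)) (functions-complete _~_ cs complete n (f ∘ suc))
    where
    prepend : ∀ {c : C} {g} → f zero ~ c → (∀ i → f (suc i) ~ g i) → ∀ i → f i ~ (c Vector.∷ g) i
    prepend p r zero = p
    prepend p r (suc i) = r i

  -- The group algebra of a cyclic group over ℤ/p

  module CyclicAlgebra (p : ℕ) (p-prime : Prime p) (N′ : ℕ) where
    private N = suc N′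
    open Cyclic N′ public
    open IntegersMod p p-prime using (ℤ/p) renaming (char to charᴷ; fixed to fixedᴷ; _≈?_ to _≈ᴷ?_)
    open CommutativeRing ℤ/p using () renaming (_≈_ to _≈ᴷ_; 0# to 0ᴷ; 1# to 1ᴷ)
    private module K = CommutativeRing ℤ/p
    open Sums (CommutativeRing.semiring ℤ/p) using (δ; sum-δʳ)
    open MonoidAlgebra ℤ/p _⊕_ zero ⊕-assoc ⊕-comm ⊕-identityˡ public
      using (algebra; δ-⊛; δ-⊛-δ; _·_; ·-^; basis-expansion)
    open CommutativeRing algebra hiding (zero) public
    open SemiringExp semiring public
    open SemiringMult semiring using () renaming (_×_ to _×#_) public
    open SemiringSum semiring using () renaming (sum to ∑ᴬ; sum-cong-≋ to ∑ᴬ-cong)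
    private module KSum = SemiringSum (CommutativeRing.semiring ℤ/p)
    private module KMult = SemiringMult (CommutativeRing.semiring ℤ/p)

    _≈?_ : ∀ f g → Dec (f ≈ g)
    f ≈? g = Fin.all? (λ i → f i ≈ᴷ? g i)

    char : p ×# 1# ≈ 0#
    char i = K.trans (K.reflexive (pointwise p)) (Characteristic.p×≈0 ℤ/p p-prime charᴷ (1# i))
      where
      pointwise : ∀ n → (n ×# 1#) i ≡ n KMult.× 1# i
      pointwise zero = ≡.refl
      pointwise (suc n) = cong (K._+_ (1# i)) (pointwise n)

    X : Carrier
    X = δ (red 1)

    X^≈δ : ∀ m → X ^ m ≈ δ (red m)
    X^≈δ zero i = K.refl {δ (red 0) i}
    X^≈δ (suc m) = begin
      X * X ^ m           ≈⟨ *-congˡ {X} (X^≈δ m) ⟩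
      X * δ (red m)       ≈⟨ δ-⊛-δ (red 1) (red m) ⟩
      δ (red 1 ⊕ red m)   ≈⟨ reflexive (cong δ (red-⊕ 1 m)) ⟩
      δ (red (suc m))     ∎
      where open SetoidReasoning setoid

    -- The exponent q = N + 1 is 1 modulo the order N of X.
    δ^q≈δ : ∀ i → δ i ^ suc N ≈ δ i
    δ^q≈δ i = begin
      δ i ^ suc N                    ≈⟨ ^-congˡ (suc N) (reflexive (cong δ (red-toℕ i))) ⟨
      δ (red (toℕ i)) ^ suc N        ≈⟨ ^-congˡ (suc N) (X^≈δ (toℕ i)) ⟨
      (X ^ toℕ i) ^ suc N            ≈⟨ ^-assocʳ X (toℕ i) (suc N) ⟩
      X ^ (toℕ i ℕ.* suc N)          ≈⟨ X^≈δ (toℕ i ℕ.* suc N) ⟩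
      δ (red (toℕ i ℕ.* suc N))      ≈⟨ reflexive (cong δ i*q≡i) ⟩
      δ (red (toℕ i))                ≈⟨ reflexive (cong δ (red-toℕ i)) ⟩
      δ i                            ∎
      where
      open SetoidReasoning setoid
      i*q≡i : red (toℕ i ℕ.* suc N) ≡ red (toℕ i)
      i*q≡i = red-cong {toℕ i ℕ.* suc N} {toℕ i}
        (≡.trans (cong (ℕ._% N) (ℕ.*-suc (toℕ i) N)) (ℕ.[m+kn]%n≡m%n (toℕ i) (toℕ i) N))

    -- The q-th power distributes over the basis expansion. It fixes the coefficients by Fermat and
    -- the group elements by `δ^q≈δ`.
    fixed : ∀ h → suc N ≡ p ℕ.^ h → ∀ y → y ^ suc N ≈ y
    fixed h N+1≡p^h y = begin
      y ^ suc N                              ≈⟨ ^-congˡ (suc N) (basis-expansion y) ⟩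
      ∑ᴬ terms ^ suc N                       ≈⟨ ^-congʳ (∑ᴬ terms) N+1≡p^h ⟩
      ∑ᴬ terms ^ (p ℕ.^ h)                   ≈⟨ Characteristic.sum-^ algebra p-prime char h terms ⟩
      ∑ᴬ (λ i → terms i ^ (p ℕ.^ h))         ≈⟨ ∑ᴬ-cong {x = λ i → terms i ^ (p ℕ.^ h)} {y = terms} term ⟩
      ∑ᴬ terms                               ≈⟨ basis-expansion y ⟨
      y                                      ∎
      where
      open SetoidReasoning setoid
      terms : Fin N → Carrier
      terms i = y i · δ i
      term : ∀ i → terms i ^ (p ℕ.^ h) ≈ terms i
      term i k = K.trans (·-^ (y i) (δ i) (p ℕ.^ h) k)
        (K.*-cong (fixedᴷ h (y i)) (trans (^-congʳ (δ i) (≡.sym N+1≡p^h)) (δ^q≈δ i) k))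

    -- Multiplying by X^a shifts coefficients cyclically; for a ≤ k the coefficient at k is read
    -- without wrapping around.
    δ-shift : ∀ a f k → a ℕ.≤ toℕ k → (δ (red a) * f) k ≈ᴷ f (red (toℕ k ℕ.∸ a))
    δ-shift a f k a≤k = K.trans (δ-⊛ (red a) f k)
      (K.trans (KSum.sum-cong-≋ (λ j → K.*-congˡ {f j} (K.reflexive (indicator j)))) (sum-δʳ f (red (toℕ k ℕ.∸ a))))
      where
      target : red a ⊕ red (toℕ k ℕ.∸ a) ≡ k
      target = ≡.trans (red-⊕ a (toℕ k ℕ.∸ a)) (≡.trans (cong red (ℕ.m+[n∸m]≡n a≤k)) (red-toℕ k))
      indicator : ∀ j → δ (red a ⊕ j) k ≡ δ j (red (toℕ k ℕ.∸ a))
      indicator j with (red a ⊕ j) Fin.≟ k | j Fin.≟ red (toℕ k ℕ.∸ a)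
      ... | yes _ | yes _ = ≡.refl
      ... | no _ | no _ = ≡.refl
      ... | yes hit | no miss = contradiction (red-⊕-cancel a j _ (≡.trans hit (≡.sym target))) miss
      ... | no miss | yes hit = contradiction (≡.trans (cong (red a ⊕_) hit) target) miss

    -- Degrees are read off the representatives 0, ..., N - 1 of the exponents. For D ≥ N both
    -- clauses are vacuous, so products can be formed without tracking the bound; it enters only in
    -- `monic≉0`.
    MonicOfDegree : ℕ → Carrier → Set
    MonicOfDegree D f = (∀ k → D ℕ.< toℕ k → f k ≈ᴷ 0ᴷ) × (∀ k → toℕ k ≡ D → f k ≈ᴷ 1ᴷ)

    monic-1 : MonicOfDegree 0 1#
    monic-1 = (λ { (suc k) _ → K.refl }) , (λ { zero _ → K.refl })

    -- Only coefficients at k ≥ D + a matter. There X^a f contributes the coefficient of f at k - a,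
    -- while X f contributes the one at k - 1 > D, which is zero because a ≥ 2.
    monic-step : ∀ D a f → 2 ℕ.≤ a → MonicOfDegree D f → MonicOfDegree (D ℕ.+ a) ((X ^ a + - X) * f)
    monic-step D a f 2≤a (above , top) =
      (λ k D+a<k → value k (ℕ.<⇒≤ D+a<k) (above (red (toℕ k ℕ.∸ a))
        (≡.subst (D ℕ.<_) (≡.sym (small k a)) (ℕ.m+n≤o⇒m≤o∸n (suc D) D+a<k)))) ,
      (λ k k≡D+a → value k (ℕ.≤-reflexive (≡.sym k≡D+a)) (top (red (toℕ k ℕ.∸ a))
        (≡.trans (small k a) (≡.trans (cong (ℕ._∸ a) k≡D+a) (ℕ.m+n∸n≡m D a)))))
      where
      small : ∀ k b → toℕ (red (toℕ k ℕ.∸ b)) ≡ toℕ k ℕ.∸ b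
      small k b = toℕ-red-< (ℕ.≤-<-trans (ℕ.m∸n≤m (toℕ k) b) (Fin.toℕ<n k))
      value : ∀ k {c} → D ℕ.+ a ℕ.≤ toℕ k → f (red (toℕ k ℕ.∸ a)) ≈ᴷ c → ((X ^ a + - X) * f) k ≈ᴷ c
      value k {c} D+a≤k eq = begin
        ((X ^ a + - X) * f) k              ≈⟨ distribʳ f (X ^ a) (- X) k ⟩
        K._+_ ((X ^ a * f) k) ((- X * f) k)
          ≈⟨ K.+-cong {(X ^ a * f) k} {c} {(- X * f) k} {0ᴷ} first second ⟩
        K._+_ c 0ᴷ                         ≈⟨ K.+-identityʳ c ⟩
        c                                  ∎
        where
        open SetoidReasoning K.setoid
        open RingProperties (CommutativeRing.ring algebra) using (-‿distribˡ-*)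
        open RingProperties (CommutativeRing.ring ℤ/p) using (-0#≈0#)
        first : (X ^ a * f) k ≈ᴷ c
        first = K.trans {(X ^ a * f) k} {(δ (red a) * f) k} (*-congʳ {f} (X^≈δ a) k)
          (K.trans (δ-shift a f k (ℕ.≤-trans (ℕ.m≤n+m a D) D+a≤k)) eq)
        second : (- X * f) k ≈ᴷ 0ᴷ
        second = K.trans {(- X * f) k} {K.-_ ((X * f) k)} (K.sym {K.-_ ((X * f) k)} {(- X * f) k} (-‿distribˡ-* X f k))
          (K.trans (K.-‿cong {(X * f) k} {0ᴷ} (K.trans (δ-shift 1 f k 1≤k) (above (red (toℕ k ℕ.∸ 1)) high))) -0#≈0#)
          where
          D+2≤k : D ℕ.+ 2 ℕ.≤ toℕ k
          D+2≤k = ℕ.≤-trans (ℕ.+-monoʳ-≤ D 2≤a) D+a≤k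
          1≤k : 1 ℕ.≤ toℕ k
          1≤k = ℕ.≤-trans (ℕ.s≤s ℕ.z≤n) (ℕ.≤-trans (ℕ.m≤n+m 2 D) D+2≤k)
          high : D ℕ.< toℕ (red (toℕ k ℕ.∸ 1))
          high = ≡.subst (D ℕ.<_) (≡.sym (small k 1)) (ℕ.m+n≤o⇒m≤o∸n (suc D) (≡.subst (ℕ._≤ toℕ k) (ℕ.+-suc D 1) D+2≤k))

    monic≉0 : ∀ {D f} → D ℕ.< N → MonicOfDegree D f → ¬ f ≈ 0#
    monic≉0 {D} {f} D<N (_ , top) f≈0 = IntegersMod.1≉0 p p-prime
      (K.trans (K.sym (top (fromℕ< D<N) (Fin.toℕ-fromℕ< D<N))) (f≈0 (fromℕ< D<N)))

    factor : ℕ → Carrier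
    factor d = X ^ (p ℕ.^ d) + - X

    P : ℕ → Carrier
    P zero = 1#
    P (suc d) = factor (suc d) * P d

    degree : ℕ → ℕ
    degree zero = 0
    degree (suc d) = degree d ℕ.+ p ℕ.^ suc d

    2≤p : 2 ℕ.≤ p
    2≤p = ℕ.nonTrivial⇒n>1 p {{prime⇒nonTrivial p-prime}}

    2≤p^1+d : ∀ d → 2 ℕ.≤ p ℕ.^ suc d
    2≤p^1+d d = ℕ.*-mono-≤ 2≤p (ℕ.m^n>0 p {{prime⇒nonZero p-prime}} d)

    P-monic : ∀ d → MonicOfDegree (degree d) (P d)
    P-monic zero = monic-1
    P-monic (suc d) = monic-step (degree d) (p ℕ.^ suc d) (P d) (2≤p^1+d d) (P-monic d)

    -- The sum p + ... + p^d stays at least 2 below p^(d+1), as p ≥ 2. The slack 2 is exactly what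
    -- places the degree of P below N = q - 1.
    degree-bound : ∀ d → degree d ℕ.+ 2 ℕ.≤ p ℕ.^ suc d
    degree-bound zero = ℕ.≤-trans 2≤p (ℕ.≤-reflexive (≡.sym (ℕ.*-identityʳ p)))
    degree-bound (suc d) = begin
      (degree d ℕ.+ Q) ℕ.+ 2    ≡⟨ ℕ.+-assoc (degree d) Q 2 ⟩
      degree d ℕ.+ (Q ℕ.+ 2)    ≡⟨ cong (degree d ℕ.+_) (ℕ.+-comm Q 2) ⟩
      degree d ℕ.+ (2 ℕ.+ Q)    ≡⟨ ℕ.+-assoc (degree d) 2 Q ⟨
      (degree d ℕ.+ 2) ℕ.+ Q    ≤⟨ ℕ.+-monoˡ-≤ Q (degree-bound d) ⟩
      Q ℕ.+ Q                   ≡⟨ cong (Q ℕ.+_) (ℕ.+-identityʳ Q) ⟨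
      2 ℕ.* Q                   ≤⟨ ℕ.*-monoˡ-≤ Q 2≤p ⟩
      p ℕ.* Q                   ∎
      where
      open ℕ.≤-Reasoning
      Q = p ℕ.^ suc d

    -- Applied in contrapositive form: an idempotent that does not kill the product kills no factor,
    -- which keeps X apart from X^(p^d) in the residue field.
    factor-annihilated⇒P-annihilated : ∀ e m d → 1 ℕ.≤ d → d ℕ.≤ m → e * factor d ≈ 0# → e * P m ≈ 0#
    factor-annihilated⇒P-annihilated e zero (suc d) _ ()
    factor-annihilated⇒P-annihilated e (suc m) d 1≤d d≤1+m e*f≈0 = split (ℕ.m≤n⇒m<n∨m≡n d≤1+m)
      where
      open SemigroupProperties (CommutativeRing.*-commutativeSemigroup algebra) using (x∙yz≈y∙xz)
      split : d ℕ.< suc m ⊎ d ≡ suc m → e * P (suc m) ≈ 0#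
      split (inj₂ d≡1+m) = trans (sym (*-assoc e (factor (suc m)) (P m)))
        (trans (*-congʳ {P m} (≡.subst (λ d → e * factor d ≈ 0#) d≡1+m e*f≈0)) (zeroˡ (P m)))
      split (inj₁ (ℕ.s≤s d≤m)) = trans (x∙yz≈y∙xz e (factor (suc m)) (P m))
        (trans (*-congˡ {factor (suc m)} (factor-annihilated⇒P-annihilated e m d 1≤d d≤m e*f≈0)) (zeroʳ (factor (suc m))))

  -- The field with p^h elements

  module ResidueField (R : Ring) (N′ : ℕ)
    (_≈?_ : ∀ x y → Dec (CommutativeRing._≈_ R x y))
    (fixed : ∀ x → CommutativeRing._≈_ R (SemiringExp._^_ (CommutativeRing.semiring R) x (suc (suc N′))) x)
    (elements : List (CommutativeRing.Carrier R))
    (complete : ∀ y → Any (CommutativeRing._≈_ R y) elements)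
    (P : CommutativeRing.Carrier R) (P≉0 : ¬ CommutativeRing._≈_ R P (CommutativeRing.0# R)) where
    open CommutativeRing R hiding (zero)
    open SemiringExp semiring
    open SemiringMult semiring using () renaming (_×_ to _×#_)
    open PrimitiveIdempotent R N′ _≈?_ fixed
    open SetoidReasoning setoid
    private N = suc N′

    P^N≉0 : ¬ P ^ N ≈ 0#
    P^N≉0 P^N≈0 = P≉0 (trans (sym (fixed P)) (trans (*-congˡ P^N≈0) (zeroʳ P)))

    private
      open module Refined = Refinement (refine (P ^ N) (y^N-idempotent P) P^N≉0 elements)
        using (nonzero; below) renaming (e′ to e)

    decided : ∀ y → Decided e y
    decided y = ListAll.lookupWith transfer Refined.decided (complete y)
      where
      transfer : ∀ {z} → Decided e z → y ≈ z → Decided e y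
      transfer (inj₁ ez≈0) y≈z = inj₁ (trans (*-congˡ y≈z) ez≈0)
      transfer (inj₂ ez^N≈e) y≈z = inj₂ (trans (*-congˡ (^-congˡ N y≈z)) ez^N≈e)

    F : Ring
    F = quotient R (localise e)

    F-field : IsField F
    F-field = localise-field e nonzero decided

    private
      module F = CommutativeRing F
      module FExp = SemiringExp F.semiring
      module FMult = SemiringMult F.semiring

      ^-same : ∀ x n → x FExp.^ n ≡ x ^ n
      ^-same x zero = ≡.refl
      ^-same x (suc n) = cong (x *_) (^-same x n)

      ×-same : ∀ n x → n FMult.× x ≡ n ×# x
      ×-same zero x = ≡.refl
      ×-same (suc n) x = cong (x +_) (×-same n x)

    -- The refinement started at P^N, so e = e P^N = (e P) P^(N-1).
    e*P≉0 : ¬ e * P ≈ 0#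
    e*P≉0 eP≈0 = nonzero (begin
      e                   ≈⟨ below ⟨
      e * (P * P ^ N′)    ≈⟨ *-assoc e P (P ^ N′) ⟨
      (e * P) * P ^ N′    ≈⟨ trans (*-congʳ eP≈0) (zeroˡ (P ^ N′)) ⟩
      0#                  ∎)

    -- The condition on α is demanded for every e, because the idempotent is produced by a search
    -- and only its existence is known outside.
    residueField : ∀ {p} → Prime p → p ×# 1# ≈ 0# → ∀ h → suc N ≡ p ℕ.^ h →
      (α : Carrier) → (∀ d e → 1 ℕ.≤ d → d ℕ.< h → e * α ^ (p ℕ.^ d) ≈ e * α → e * P ≈ 0#) →
      FiniteField (p ℕ.^ h)
    residueField {p} p-prime char h q≡p^h α moved = PrimePowerOrder.finiteField F F-field p-prime
      (≡.subst (F._≈ 0#) (≡.sym (×-same p 1#)) (on (*-congˡ char)))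
      h (λ x → ≡.subst (λ m → x FExp.^ m F.≈ x) q≡p^h (≡.subst (F._≈ x) (≡.sym (^-same x (suc N))) (on (*-congˡ (fixed x)))))
      α (λ d 1≤d d<h eq → e*P≉0 (moved d e 1≤d d<h (EqualOn.equal (≡.subst (F._≈ α) (^-same α (p ℕ.^ d)) eq))))
      (≡.subst (2 ℕ.≤_) q≡p^h (ℕ.s≤s (ℕ.s≤s ℕ.z≤n)))

  finite-field-of-order : ∀ {p} → Prime p → ∀ h → FiniteField (p ℕ.^ suc h)
  finite-field-of-order {p} p-prime h = residueField p-prime char (suc h) q≡p^h X moved
    where
    -- The cyclic group has order N = N′ + 1 = q - 1.
    N′ = p ℕ.^ suc h ℕ.∸ 2
    open CyclicAlgebra p p-prime N′
    q≡p^h : 2 ℕ.+ N′ ≡ p ℕ.^ suc h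
    q≡p^h = ℕ.m+[n∸m]≡n (2≤p^1+d h)
    degree<N : degree h ℕ.< suc N′
    degree<N = ℕ.≤-pred (ℕ.≤-trans (ℕ.≤-reflexive (ℕ.+-comm 2 (degree h)))
      (≡.subst (degree h ℕ.+ 2 ℕ.≤_) (≡.sym q≡p^h) (degree-bound h)))
    open IntegersMod p p-prime using (residues; residues-complete; _≡ₚ_)
    open ResidueField algebra N′ _≈?_ (fixed (suc h) q≡p^h)
      (functions residues (suc N′)) (functions-complete _≡ₚ_ residues residues-complete (suc N′))
      (P h) (monic≉0 degree<N (P-monic h))
    open RingProperties (CommutativeRing.ring algebra) using (-‿distribʳ-*)
    moved : ∀ d e → 1 ℕ.≤ d → d ℕ.< suc h → e * X ^ (p ℕ.^ d) ≈ e * X → e * P h ≈ 0#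
    moved d e 1≤d (ℕ.s≤s d≤h) eq = factor-annihilated⇒P-annihilated e h d 1≤d d≤h (begin
      e * (X ^ (p ℕ.^ d) + - X)          ≈⟨ distribˡ e (X ^ (p ℕ.^ d)) (- X) ⟩
      e * X ^ (p ℕ.^ d) + e * - X        ≈⟨ +-cong {e * X ^ (p ℕ.^ d)} {e * X} eq negated ⟩
      e * X + - (e * X)                  ≈⟨ -‿inverseʳ (e * X) ⟩
      0#                                 ∎)
      where
      open SetoidReasoning setoid
      negated : e * - X ≈ - (e * X)
      negated = sym { - (e * X)} {e * - X} (-‿distribʳ-* e X)

  -- Coordinates over a finite field

  -- Affine plane coordinates: the line of direction m through the point u is labelled by word u m.
  -- Direction zero is vertical, and direction suc m is slope m.
  record OrthogonalArray (q : ℕ) : Set where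
    field
      word : Fin q × Fin q → Fin (suc q) → Fin q
      agree : ∀ u v → u ≢ v → ∃ λ m → word u m ≡ word v m × (∀ m′ → word u m′ ≡ word v m′ → m′ ≡ m)
      word-vertical : ∀ x y → word (x , y) zero ≡ x
      ordinate : Fin q → Fin q → Fin q → Fin q
      word-ordinate : ∀ m b x → word (x , ordinate m b x) (suc m) ≡ b

  module _ {q : ℕ} (𝔽 : FiniteField q) where
    open FiniteField 𝔽
    open CommutativeRing ring hiding (zero; ring)
    open IsField isField
    open FieldProperties ring isField
    open RingProperties (CommutativeRing.ring ring) using (-‿distribʳ-*; +-cancelʳ)
    open SetoidReasoning setoid

    private
      index : Carrier → Fin q
      index x = proj₁ (enumerate-surjective x)

      enumerate-index : ∀ x → enumerate (index x) ≈ x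
      enumerate-index x = proj₂ (enumerate-surjective x)

      index-cong : ∀ {x y} → x ≈ y → index x ≡ index y
      index-cong {x} {y} x≈y = enumerate-injective _ _ (trans (enumerate-index x) (trans x≈y (sym (enumerate-index y))))

      index-injective : ∀ {x y} → index x ≡ index y → x ≈ y
      index-injective {x} {y} eq = trans (sym (enumerate-index x)) (trans (reflexive (cong enumerate eq)) (enumerate-index y))

      cancel-middle : ∀ u v z → (u + - v) + (v + z) ≈ u + z
      cancel-middle u v z = begin
        (u + - v) + (v + z)   ≈⟨ +-assoc u (- v) (v + z) ⟩
        u + (- v + (v + z))   ≈⟨ +-congˡ (+-assoc (- v) v z) ⟨
        u + ((- v + v) + z)   ≈⟨ +-congˡ (trans (+-congʳ (-‿inverseˡ v)) (+-identityˡ z)) ⟩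
        u + z                 ∎

      difference⇒sum : ∀ {u v w z} → u + - v ≈ w + - z → u + z ≈ w + v
      difference⇒sum {u} {v} {w} {z} eq = begin
        u + z                 ≈⟨ cancel-middle u v z ⟨
        (u + - v) + (v + z)   ≈⟨ +-cong eq (+-comm v z) ⟩
        (w + - z) + (z + v)   ≈⟨ cancel-middle w z v ⟩
        w + v                 ∎

      sum⇒difference : ∀ {u v w z} → u + z ≈ w + v → u + - v ≈ w + - z
      sum⇒difference {u} {v} {w} {z} eq = +-cancelʳ (v + z) (u + - v) (w + - z) (begin
        (u + - v) + (v + z)   ≈⟨ cancel-middle u v z ⟩
        u + z                 ≈⟨ eq ⟩
        w + v                 ≈⟨ cancel-middle w z v ⟨
        (w + - z) + (z + v)   ≈⟨ +-congˡ (+-comm z v) ⟩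
        (w + - z) + (v + z)   ∎)

      intercept : Carrier → Carrier → Carrier → Carrier
      intercept m x y = y + - (m * x)

      *-distrib-difference : ∀ m x x′ → m * (x + - x′) ≈ m * x + - (m * x′)
      *-distrib-difference m x x′ = trans (distribˡ m x (- x′)) (+-congˡ (sym (-‿distribʳ-* m x′)))

      intercepts⇒slope : ∀ {m x y x′ y′} → intercept m x y ≈ intercept m x′ y′ → m * (x + - x′) ≈ y + - y′
      intercepts⇒slope {m} {x} {y} {x′} {y′} eq = trans (*-distrib-difference m x x′)
        (sum⇒difference (trans (+-comm (m * x) y′) (sym (difference⇒sum eq))))

      slope⇒intercepts : ∀ {m x y x′ y′} → m * (x + - x′) ≈ y + - y′ → intercept m x y ≈ intercept m x′ y′
      slope⇒intercepts {m} {x} {y} {x′} {y′} eq = sum⇒difference (trans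
        (sym (difference⇒sum (trans (sym (*-distrib-difference m x x′)) eq))) (+-comm (m * x) y′))

      word : Fin q × Fin q → Fin (suc q) → Fin q
      word (x , y) zero = x
      word (x , y) (suc m) = index (intercept (enumerate m) (enumerate x) (enumerate y))

      agree : ∀ u v → u ≢ v → ∃ λ m → word u m ≡ word v m × (∀ m′ → word u m′ ≡ word v m′ → m′ ≡ m)
      agree (x , y) (x′ , y′) u≢v with x Fin.≟ x′
      ... | yes ≡.refl = zero , ≡.refl , unique
        where
        unique : ∀ m′ → word (x , y) m′ ≡ word (x , y′) m′ → m′ ≡ zero
        unique zero _ = ≡.refl
        -- Over a common abscissa, equal intercepts for a finite slope would force equal ordinates.
        unique (suc m) eq = contradiction (cong (x ,_) (enumerate-injective y y′
          (+-cancelʳ _ _ _ (index-injective eq)))) u≢v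
      -- The common direction is the slope dy / dx; uniqueness cancels dx with the same inverse.
      ... | no x≢x′ = suc (index s) , index-cong (slope⇒intercepts slope) , unique
        where
        dx = enumerate x + - enumerate x′
        dy = enumerate y + - enumerate y′
        inverse : ∃ λ w → dx * w ≈ 1#
        inverse = invertible dx (≉⇒difference≉0 (x≢x′ ∘ enumerate-injective x x′))
        w = proj₁ inverse
        s = dy * w
        slope : enumerate (index s) * dx ≈ dy
        slope = begin
          enumerate (index s) * dx   ≈⟨ *-congʳ (enumerate-index s) ⟩
          (dy * w) * dx              ≈⟨ *-assoc dy w dx ⟩
          dy * (w * dx)              ≈⟨ *-congˡ (trans (*-comm w dx) (proj₂ inverse)) ⟩
          dy * 1#                    ≈⟨ *-identityʳ dy ⟩
          dy                         ∎
        unique : ∀ m′ → word (x , y) m′ ≡ word (x′ , y′) m′ → m′ ≡ suc (index s)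
        unique zero eq = contradiction eq x≢x′
        unique (suc m) eq = cong suc (enumerate-injective m (index s) (begin
          enumerate m                ≈⟨ *-identityʳ _ ⟨
          enumerate m * 1#           ≈⟨ *-congˡ (proj₂ inverse) ⟨
          enumerate m * (dx * w)     ≈⟨ *-assoc _ dx w ⟨
          (enumerate m * dx) * w     ≈⟨ *-congʳ (intercepts⇒slope (index-injective eq)) ⟩
          s                          ≈⟨ enumerate-index s ⟨
          enumerate (index s)        ∎))

      ordinate : Fin q → Fin q → Fin q → Fin q
      ordinate m b x = index (enumerate b + enumerate m * enumerate x)

      word-ordinate : ∀ m b x → word (x , ordinate m b x) (suc m) ≡ b
      word-ordinate m b x = enumerate-injective _ _ (trans (enumerate-index _) (begin
        enumerate (ordinate m b x) + - mx   ≈⟨ +-congʳ (enumerate-index _) ⟩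
        (enumerate b + mx) + - mx           ≈⟨ +-assoc _ mx (- mx) ⟩
        enumerate b + (mx + - mx)           ≈⟨ trans (+-congˡ (-‿inverseʳ mx)) (+-identityʳ _) ⟩
        enumerate b                         ∎))
        where mx = enumerate m * enumerate x

    orthogonalArray : OrthogonalArray q
    orthogonalArray = record
      { word = word ; agree = agree ; word-vertical = λ _ _ → ≡.refl
      ; ordinate = ordinate ; word-ordinate = word-ordinate }

module Partitions where
  open import Defs
  open FiniteFields using (module Sums; OrthogonalArray; orthogonalArray; finite-field-of-order)
  open import Data.Bool.Base using (Bool; true; false; _∧_; T; if_then_else_)
  open import Data.Bool.Properties using (T-∧)
  open import Data.Empty using (⊥-elim)
  open import Data.Fin.Base using (Fin; zero; suc; toℕ; combine; remQuot; splitAt; join)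
  import Data.Fin.Properties as Fin
  open import Data.Integer.Base as ℤ using (ℤ; +≤+) renaming (+_ to pos)
  import Data.Integer.Properties as ℤ
  open import Data.Integer.Tactic.RingSolver using () renaming (solve-∀ to ℤ-solve-∀)
  open import Data.List.Base using (List; []; _∷_; _++_; map; length; filterᵇ; tabulate; cartesianProduct)
  open import Data.List.Properties using (length-++; filter-++)
  open import Data.Nat.Base as ℕ using (ℕ; zero; suc; _+_; _*_; _∸_; _≤_; _<_; _<ᵇ_; z≤n; s≤s)
  open import Data.Nat.Primality using (prime⇒nonZero; prime⇒nonTrivial)
  import Data.Nat.Properties as ℕ
  open import Data.Nat.Tactic.RingSolver using () renaming (solve-∀ to ℕ-solve-∀)
  open import Data.Product.Base using (_×_; _,_; ∃; proj₁; proj₂)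
  open import Data.Rational.Base as ℚ using (ℚ)
  import Data.Rational.Properties as ℚ
  import Data.Rational.Unnormalised.Base as ℚᵘ
  import Data.Rational.Unnormalised.Properties as ℚᵘ
  open import Data.Sum.Base as Sum using (_⊎_; inj₁; inj₂)
  import Data.Sum.Properties as Sum
  open import Data.Unit.Base using (tt)
  open import Function.Base using (_∘_; id)
  open import Function.Bundles using (Equivalence)
  open import Relation.Binary.Definitions using (tri<; tri≈; tri>)
  open import Relation.Binary.PropositionalEquality as ≡ using (_≡_; _≢_; refl; sym; trans; cong; cong₂; subst)
  import Relation.Binary.Reasoning.Setoid as SetoidReasoning
  open import Relation.Nullary.Decidable.Core using (Dec; yes; no; ⌊_⌋; T?; toWitness; fromWitness)
  open import Relation.Nullary.Negation using (¬_; contradiction)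
  open Sums ℕ.+-*-semiring using (sum; δ; sum-δ; sum-δʳ; sum-cong-≗; ∑-comm; ∑-distrib-+; *-distribˡ-sum; *-distribʳ-sum)

  -- Linear spaces with r lines through every point

  record LinearSpace (P L : Set) (r : ℕ) : Set where
    field
      pencil : P → Fin r → L
      pencil-injective : ∀ p s t → pencil p s ≡ pencil p t → s ≡ t

    -- Incidence is derived from the pencils, so the constant number r of lines through a point is
    -- built in and incidences can be counted point by point.
    _on_ : P → L → Set
    p on l = ∃ λ t → pencil p t ≡ l

    field
      line-through : ∀ p p′ → p ≢ p′ → ∃ λ l → p on l × p′ on l × (∀ l′ → p on l′ → p′ on l′ → l′ ≡ l)

  module _ {P L : Set} {r : ℕ} (S : LinearSpace P L r) where
    open LinearSpace S

    Covered : Set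
    Covered = ∀ l → ∃ λ p → p on l

    -- Two points on every line ensure that each line keeps a point when any one point is deleted.
    Thick : Set
    Thick = ∀ l → ∃ λ p → ∃ λ p′ → p ≢ p′ × p on l × p′ on l

    module _ {P′ L′ : Set} (f : P′ → P) (f-injective : ∀ {x y} → f x ≡ f y → x ≡ y)
             (g : L′ → L) (g-injective : ∀ {x y} → g x ≡ g y → x ≡ y)
             (lift : ∀ p t → ∃ λ l → g l ≡ pencil (f p) t) where

      private
        pencil′ : P′ → Fin r → L′
        pencil′ p t = proj₁ (lift p t)

        down : ∀ {p l} → (∃ λ t → pencil′ p t ≡ l) → f p on g l
        down {p} (t , eq) = t , trans (sym (proj₂ (lift p t))) (cong g eq)

      up : ∀ {p l} → f p on g l → ∃ λ t → pencil′ p t ≡ l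
      up {p} (t , eq) = t , g-injective (trans (proj₂ (lift p t)) eq)

      -- `lift` says that every line through a retained point is retained. Lines may become shorter,
      -- but every pencil keeps its r lines and every pair of points its line.
      restrict : LinearSpace P′ L′ r
      restrict = record
        { pencil = pencil′
        ; pencil-injective = λ p s t eq → pencil-injective (f p) s t
            (trans (sym (proj₂ (lift p s))) (trans (cong g eq) (proj₂ (lift p t))))
        ; line-through = through }
        where
        through : ∀ p p′ → p ≢ p′ → ∃ λ l → (∃ λ t → pencil′ p t ≡ l) × (∃ λ t → pencil′ p′ t ≡ l) ×
          (∀ l′ → (∃ λ t → pencil′ p t ≡ l′) → (∃ λ t → pencil′ p′ t ≡ l′) → l′ ≡ l)
        through p p′ p≢p′ with line-through (f p) (f p′) (p≢p′ ∘ f-injective)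
        ... | l , (t , eq) , p′-on , unique = pencil′ p t , (t , refl) , up (subst (f p′ on_) l≡ p′-on) ,
          λ l′ a b → g-injective (trans (unique (g l′) (down a) (down b)) l≡)
          where
          l≡ : l ≡ g (pencil′ p t)
          l≡ = trans (sym eq) (sym (proj₂ (lift p t)))

    thick⇒covered : Thick → Covered
    thick⇒covered thick l with thick l
    ... | p , _ , _ , p-on , _ = p , p-on

  module _ {L : Set} {n r : ℕ} (S : LinearSpace (Fin (suc n)) L r) where
    open LinearSpace S

    delete-point : LinearSpace (Fin n) L r
    delete-point = restrict S suc Fin.suc-injective id id (λ p t → pencil (suc p) t , refl)

    delete-point-covered : Thick S → Covered delete-point
    delete-point-covered thick l with thick l
    ... | suc p , _ , _ , p-on , _ = p , p-on
    ... | zero , suc p′ , _ , _ , p′-on = p′ , p′-on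
    ... | zero , zero , 0≢0 , _ = contradiction refl 0≢0

  -- Affine, projective and punctured planes

  module Planes {m : ℕ} (oa : OrthogonalArray (2 ℕ.+ m)) where
    private q = 2 ℕ.+ m
    open OrthogonalArray oa

    affine-plane : LinearSpace (Fin q × Fin q) (Fin (suc q) × Fin q) (suc q)
    affine-plane = record
      { pencil = λ u d → d , word u d
      ; pencil-injective = λ u s t eq → cong proj₁ eq
      ; line-through = through }
      where
      through : ∀ u v → u ≢ v → _
      through u v u≢v with agree u v u≢v
      ... | d , eq , unique = (d , word u d) , (d , refl) , (d , cong (d ,_) (sym eq)) ,
        λ { _ (s , refl) (t , eq′) → aux s t eq′ }
        where
        aux : ∀ s t → (t , word v t) ≡ (s , word u s) → (s , word u s) ≡ (d , word u d)
        aux s t eq′ with cong proj₁ eq′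
        ... | refl with unique s (sym (cong proj₂ eq′))
        ... | refl = refl

    point-on : Fin (suc q) → Fin q → Fin q → Fin q × Fin q
    point-on zero b t = b , t
    point-on (suc s) b t = t , ordinate s b t

    word-point-on : ∀ d b t → word (point-on d b t) d ≡ b
    word-point-on zero b t = word-vertical b t
    word-point-on (suc s) b t = word-ordinate s b t

    point-on-injective : ∀ d b {s t} → point-on d b s ≡ point-on d b t → s ≡ t
    point-on-injective zero b eq = cong proj₂ eq
    point-on-injective (suc _) b eq = cong proj₁ eq

    0≢1 : ∀ {n} → _≢_ {A = Fin (2 ℕ.+ n)} zero (suc zero)
    0≢1 ()

    affine-thick : Thick affine-plane
    affine-thick (d , b) = point-on d b zero , point-on d b (suc zero) , 0≢1 ∘ point-on-injective d b ,
      (d , cong (d ,_) (word-point-on d b zero)) , (d , cong (d ,_) (word-point-on d b (suc zero)))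

    private
      ProjectivePoint = (Fin q × Fin q) ⊎ Fin (suc q)
      ProjectiveLine = (Fin (suc q) × Fin q) ⊎ Fin 1

      -- The projective completion: each direction becomes a point on its q parallel lines and on
      -- the line at infinity, hence again on q + 1 lines.
      projective-pencil : ProjectivePoint → Fin (suc q) → ProjectiveLine
      projective-pencil (inj₁ u) d = inj₁ (d , word u d)
      projective-pencil (inj₂ d) zero = inj₂ zero
      projective-pencil (inj₂ d) (suc b) = inj₁ (d , b)

      _∈_ : ProjectivePoint → ProjectiveLine → Set
      p ∈ l = ∃ λ t → projective-pencil p t ≡ l

      projective-injective : ∀ p s t → projective-pencil p s ≡ projective-pencil p t → s ≡ t
      projective-injective (inj₁ u) s t eq = cong proj₁ (Sum.inj₁-injective eq)
      projective-injective (inj₂ d) zero zero eq = refl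
      projective-injective (inj₂ d) (suc s) (suc t) eq = cong (suc ∘ proj₂) (Sum.inj₁-injective eq)

      ideal : ∀ {d d′ b} → inj₂ d ∈ inj₁ (d′ , b) → d ≡ d′
      ideal (suc t , eq) = cong proj₁ (Sum.inj₁-injective eq)

      affine : ∀ {u d b} → inj₁ u ∈ inj₁ (d , b) → word u d ≡ b
      affine (t , eq) with Sum.inj₁-injective eq
      ... | refl = refl

      not-at-infinity : ∀ {u} → ¬ (inj₁ u ∈ inj₂ zero)
      not-at-infinity (t , ())

      Line-through : ProjectivePoint → ProjectivePoint → Set
      Line-through p p′ = ∃ λ l → p ∈ l × p′ ∈ l × (∀ l′ → p ∈ l′ → p′ ∈ l′ → l′ ≡ l)

      swap : ∀ {p p′} → Line-through p p′ → Line-through p′ p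
      swap (l , a , b , unique) = l , b , a , λ l′ c d → unique l′ d c

      affine-ideal : ∀ u d → Line-through (inj₁ u) (inj₂ d)
      affine-ideal u d = inj₁ (d , word u d) , (d , refl) , (suc (word u d) , refl) , unique
        where
        unique : ∀ l′ → inj₁ u ∈ l′ → inj₂ d ∈ l′ → l′ ≡ inj₁ (d , word u d)
        unique (inj₂ zero) a _ = contradiction a not-at-infinity
        unique (inj₁ (d′ , b)) a c with ideal c | affine a
        ... | refl | refl = refl

      projective-line-through : ∀ p p′ → p ≢ p′ → Line-through p p′
      projective-line-through (inj₁ u) (inj₁ v) u≢v with agree u v (u≢v ∘ cong inj₁)
      ... | d , eq , unique = inj₁ (d , word u d) , (d , refl) , (d , cong (λ b → inj₁ (d , b)) (sym eq)) , unique′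
        where
        unique′ : ∀ l′ → inj₁ u ∈ l′ → inj₁ v ∈ l′ → l′ ≡ inj₁ (d , word u d)
        unique′ (inj₂ zero) a _ = contradiction a not-at-infinity
        unique′ (inj₁ (d′ , b)) a c with affine a | affine c
        ... | refl | eq′ with unique d′ (sym eq′)
        ... | refl = refl
      projective-line-through (inj₁ u) (inj₂ d) _ = affine-ideal u d
      projective-line-through (inj₂ d) (inj₁ u) _ = swap {inj₁ u} {inj₂ d} (affine-ideal u d)
      projective-line-through (inj₂ d) (inj₂ d′) d≢d′ = inj₂ zero , (zero , refl) , (zero , refl) , unique
        where
        unique : ∀ l′ → inj₂ d ∈ l′ → inj₂ d′ ∈ l′ → l′ ≡ inj₂ zero
        unique (inj₂ zero) _ _ = refl
        unique (inj₁ _) a c = contradiction (cong inj₂ (trans (ideal a) (sym (ideal c)))) d≢d′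

    projective-plane : LinearSpace ProjectivePoint ProjectiveLine (suc q)
    projective-plane = record
      { pencil = projective-pencil
      ; pencil-injective = projective-injective
      ; line-through = projective-line-through }

    projective-thick : Thick projective-plane
    projective-thick (inj₂ zero) = inj₂ zero , inj₂ (suc zero) , 0≢1 ∘ Sum.inj₂-injective , (zero , refl) , (zero , refl)
    projective-thick (inj₁ (d , b)) with affine-thick (d , b)
    ... | u , v , u≢v , (s , eq) , (t , eq′) = inj₁ u , inj₁ v , u≢v ∘ Sum.inj₁-injective ,
      (s , cong inj₁ eq) , (t , cong inj₁ eq′)

    -- The affine plane without the points of the vertical line labelled zero, and without that line.
    punctured-plane : LinearSpace (Fin (suc m) × Fin q) ((Fin q × Fin q) ⊎ Fin (suc m)) (suc q)
    punctured-plane = restrict affine-plane point point-injective line line-injective lift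
      where
      point : Fin (suc m) × Fin q → Fin q × Fin q
      point (x , y) = suc x , y
      line : (Fin q × Fin q) ⊎ Fin (suc m) → Fin (suc q) × Fin q
      line (inj₁ (s , b)) = suc s , b
      line (inj₂ b) = zero , suc b
      point-injective : ∀ {u v} → point u ≡ point v → u ≡ v
      point-injective refl = refl
      line-injective : ∀ {k l} → line k ≡ line l → k ≡ l
      line-injective {inj₁ _} {inj₁ _} refl = refl
      line-injective {inj₂ _} {inj₂ _} refl = refl
      lift : ∀ u d → ∃ λ l → line l ≡ (d , word (point u) d)
      -- A retained point has a successor as abscissa, so its vertical line is not the removed one.
      lift (x , y) zero = inj₂ x , cong (zero ,_) (sym (word-vertical (suc x) y))
      lift u (suc s) = inj₁ (s , word (point u) (suc s)) , refl

    punctured-covered : Covered punctured-plane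
    -- A line that is not vertical meets every vertical line, in particular the retained one at
    -- abscissa 1.
    punctured-covered (inj₁ (s , b)) = (zero , ordinate s b (suc zero)) , suc s ,
      cong (λ c → inj₁ (s , c)) (word-ordinate s b (suc zero))
    punctured-covered (inj₂ b) = (b , zero) , zero , refl

  -- Labelling points and lines by finite ordinals

  record Enumeration (A : Set) (n : ℕ) : Set where
    field
      to : Fin n → A
      from : A → Fin n
      to-from : ∀ a → to (from a) ≡ a
      from-to : ∀ i → from (to i) ≡ i

    to-injective : ∀ {i j} → to i ≡ to j → i ≡ j
    to-injective eq = trans (sym (from-to _)) (trans (cong from eq) (from-to _))

    from-injective : ∀ {a b} → from a ≡ from b → a ≡ b
    from-injective eq = trans (sym (to-from _)) (trans (cong to eq) (to-from _))

  enumerate-× : ∀ m n → Enumeration (Fin m × Fin n) (m ℕ.* n)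
  enumerate-× m n = record
    { to = remQuot {m} n ; from = λ (i , j) → combine i j
    ; to-from = λ (i , j) → Fin.remQuot-combine i j ; from-to = Fin.combine-remQuot {m} n }

  enumerate-⊎ : ∀ {A : Set} {m} n → Enumeration A m → Enumeration (A ⊎ Fin n) (m ℕ.+ n)
  enumerate-⊎ {A} {m} n E = record
    { to = Sum.map₁ to ∘ splitAt m
    ; from = join m n ∘ Sum.map₁ from
    ; to-from = to-from′
    ; from-to = λ i → trans (cong (join m n) (from-to′ (splitAt m i))) (Fin.join-splitAt m n i) }
    where
    open Enumeration E
    to-from′ : ∀ a → Sum.map₁ to (splitAt m (join m n (Sum.map₁ from a))) ≡ a
    to-from′ (inj₁ a) = trans (cong (Sum.map₁ to) (Fin.splitAt-join m n (inj₁ (from a)))) (cong inj₁ (to-from a))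
    to-from′ (inj₂ j) = cong (Sum.map₁ to) (Fin.splitAt-join m n (inj₂ j))
    from-to′ : ∀ (x : Fin m ⊎ Fin n) → Sum.map₁ from (Sum.map₁ to x) ≡ x
    from-to′ (inj₁ i) = cong inj₁ (from-to i)
    from-to′ (inj₂ j) = refl

  module _ {P L : Set} {r n k : ℕ} (EP : Enumeration P n) (EL : Enumeration L k) (S : LinearSpace P L r) where
    private
      module EP = Enumeration EP
      module EL = Enumeration EL
    open LinearSpace S

    enumerated : LinearSpace (Fin n) (Fin k) r
    enumerated = restrict S EP.to EP.to-injective EL.to EL.to-injective
      (λ p t → EL.from (pencil (EP.to p) t) , EL.to-from _)

    private
      move : ∀ {p l} → p on EL.to l → LinearSpace._on_ enumerated (EP.from p) l
      move {p} {l} p-on = up S EP.to EP.to-injective EL.to EL.to-injective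
        (λ p t → EL.from (pencil (EP.to p) t) , EL.to-from _) (subst (_on EL.to l) (sym (EP.to-from p)) p-on)

    enumerated-covered : Covered S → Covered enumerated
    enumerated-covered covered l with covered (EL.to l)
    ... | p , p-on = EP.from p , move p-on

    enumerated-thick : Thick S → Thick enumerated
    enumerated-thick thick l with thick (EL.to l)
    ... | p , p′ , p≢p′ , p-on , p′-on = EP.from p , EP.from p′ , p≢p′ ∘ EP.from-injective , move p-on , move p′-on

  -- Counting with indicator sums

  ⟦_⟧ : Bool → ℕ
  ⟦ b ⟧ = if b then 1 else 0

  ⟦∧⟧ : ∀ a b → ⟦ a ∧ b ⟧ ≡ ⟦ a ⟧ * ⟦ b ⟧
  ⟦∧⟧ true b = sym (ℕ.*-identityˡ ⟦ b ⟧)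
  ⟦∧⟧ false b = refl

  ⟦⟧-idem : ∀ b → ⟦ b ⟧ * ⟦ b ⟧ ≡ ⟦ b ⟧
  ⟦⟧-idem true = refl
  ⟦⟧-idem false = refl

  ⟦⟧-mono : ∀ {a b} → (T a → T b) → ⟦ a ⟧ ≤ ⟦ b ⟧
  ⟦⟧-mono {false} _ = z≤n
  ⟦⟧-mono {true} {true} _ = s≤s z≤n
  ⟦⟧-mono {true} {false} a⇒b = ⊥-elim (a⇒b tt)

  T⇒true : ∀ {b} → T b → b ≡ true
  T⇒true {true} _ = refl

  ¬T⇒false : ∀ {b} → ¬ T b → b ≡ false
  ¬T⇒false {true} ¬t = ⊥-elim (¬t tt)
  ¬T⇒false {false} _ = refl

  sum-mono : ∀ {n} {f g : Fin n → ℕ} → (∀ i → f i ≤ g i) → sum f ≤ sum g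
  sum-mono {zero} f≤g = z≤n
  sum-mono {suc n} f≤g = ℕ.+-mono-≤ (f≤g zero) (sum-mono (f≤g ∘ suc))

  sum-const : ∀ n c → sum {n} (λ _ → c) ≡ n * c
  sum-const zero c = refl
  sum-const (suc n) c = cong (c ℕ.+_) (sum-const n c)

  sum₂-cong : ∀ {m n} {f g : Fin m → Fin n → ℕ} → (∀ i j → f i j ≡ g i j) →
              sum (λ i → sum (f i)) ≡ sum (λ i → sum (g i))
  sum₂-cong eq = sum-cong-≗ (λ i → sum-cong-≗ (eq i))

  module _ {A : Set} where
    count : (A → Bool) → List A → ℕ
    count p xs = length (filterᵇ p xs)

    count-∷ : ∀ p x xs → count p (x ∷ xs) ≡ ⟦ p x ⟧ + count p xs
    count-∷ p x xs with p x
    ... | true = refl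
    ... | false = refl

    count-++ : ∀ p xs ys → count p (xs ++ ys) ≡ count p xs + count p ys
    count-++ p xs ys = trans (cong length (filter-++ (T? ∘ p) xs ys)) (length-++ (filterᵇ p xs))

    count-filter : ∀ p r xs → count p (filterᵇ r xs) ≡ count (λ x → r x ∧ p x) xs
    count-filter p r [] = refl
    count-filter p r (x ∷ xs) = trans head≡ (trans (cong (⟦ r x ∧ p x ⟧ +_) (count-filter p r xs))
      (sym (count-∷ (λ x → r x ∧ p x) x xs)))
      where
      head≡ : count p (filterᵇ r (x ∷ xs)) ≡ ⟦ r x ∧ p x ⟧ + count p (filterᵇ r xs)
      head≡ with r x
      ... | true = count-∷ p x (filterᵇ r xs)
      ... | false = refl

    count-tabulate : ∀ p {n} (f : Fin n → A) → count p (tabulate f) ≡ sum (λ i → ⟦ p (f i) ⟧)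
    count-tabulate p {zero} f = refl
    count-tabulate p {suc n} f = trans (count-∷ p (f zero) (tabulate (f ∘ suc)))
      (cong (⟦ p (f zero) ⟧ +_) (count-tabulate p (f ∘ suc)))

  count-map : ∀ {A B : Set} (p : B → Bool) (f : A → B) xs → count p (map f xs) ≡ count (p ∘ f) xs
  count-map p f [] = refl
  count-map p f (x ∷ xs) = trans (count-∷ p (f x) (map f xs))
    (trans (cong (⟦ p (f x) ⟧ +_) (count-map p f xs)) (sym (count-∷ (p ∘ f) x xs)))

  count-cartesianProduct : ∀ {A B : Set} (p : A × B → Bool) {m n} (f : Fin m → A) (g : Fin n → B) →
    count p (cartesianProduct (tabulate f) (tabulate g)) ≡ sum (λ i → sum λ j → ⟦ p (f i , g j) ⟧)
  count-cartesianProduct p {zero} f g = refl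
  count-cartesianProduct p {suc m} f g = trans
    (count-++ p (map (f zero ,_) (tabulate g)) (cartesianProduct (tabulate (f ∘ suc)) (tabulate g)))
    (cong₂ _+_ (trans (count-map p (f zero ,_) (tabulate g)) (count-tabulate (λ b → p (f zero , b)) g))
      (count-cartesianProduct p (f ∘ suc) g))

  numVerts-sum : ∀ {n} (S : Fin n → Bool) → numVerts S ≡ sum (λ i → ⟦ S i ⟧)
  numVerts-sum S = count-tabulate S id

  module _ {n : ℕ} where

    lt : Fin n → Fin n → ℕ
    lt i j = ⟦ toℕ i <ᵇ toℕ j ⟧

    numEdges-sum : (G : Graph n) → numEdges G ≡ sum (λ i → sum λ j → ⟦ (toℕ i <ᵇ toℕ j) ∧ G i j ⟧)
    numEdges-sum G = trans
      (count-filter (λ p → G (proj₁ p) (proj₂ p)) (λ p → toℕ (proj₁ p) <ᵇ toℕ (proj₂ p))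
        (cartesianProduct (tabulate id) (tabulate id)))
      (count-cartesianProduct (λ p → (toℕ (proj₁ p) <ᵇ toℕ (proj₂ p)) ∧ G (proj₁ p) (proj₂ p)) id id)

    numVerts-mono : {S S′ : Fin n → Bool} → (∀ i → T (S i) → T (S′ i)) → numVerts S ≤ numVerts S′
    numVerts-mono {S} {S′} S⊆S′ = ℕ.≤-trans (ℕ.≤-reflexive (numVerts-sum S))
      (ℕ.≤-trans (sum-mono (λ i → ⟦⟧-mono (S⊆S′ i))) (ℕ.≤-reflexive (sym (numVerts-sum S′))))

    numEdges-mono : {G G′ : Graph n} → (∀ i j → toℕ i < toℕ j → T (G i j) → T (G′ i j)) → numEdges G ≤ numEdges G′
    numEdges-mono {G} {G′} G⊆G′ = ℕ.≤-trans (ℕ.≤-reflexive (numEdges-sum G))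
      (ℕ.≤-trans (sum-mono (λ i → sum-mono (λ j → ⟦⟧-mono (step i j)))) (ℕ.≤-reflexive (sym (numEdges-sum G′))))
      where
      step : ∀ i j → T ((toℕ i <ᵇ toℕ j) ∧ G i j) → T ((toℕ i <ᵇ toℕ j) ∧ G′ i j)
      step i j t with Equivalence.to T-∧ t
      ... | i<j , e = Equivalence.from T-∧ (i<j , G⊆G′ i j (ℕ.<ᵇ⇒< (toℕ i) (toℕ j) i<j) e)

    clique : (Fin n → Bool) → Graph n
    clique S i j = S i ∧ S j

    trichotomy : ∀ (i j : Fin n) → (lt i j + lt j i) + δ i j ≡ 1
    trichotomy i j with i Fin.≟ j | ℕ.<-cmp (toℕ i) (toℕ j)
    ... | yes refl | tri≈ i≮i _ _ = cong (λ b → (⟦ b ⟧ + ⟦ b ⟧) + 1) (¬T⇒false (i≮i ∘ ℕ.<ᵇ⇒< (toℕ i) (toℕ i)))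
    ... | yes refl | tri< _ i≢i _ = contradiction refl i≢i
    ... | yes refl | tri> _ i≢i _ = contradiction refl i≢i
    ... | no i≢j | tri≈ _ i≡j _ = contradiction (Fin.toℕ-injective i≡j) i≢j
    ... | no _ | tri< i<j _ j≮i rewrite T⇒true (ℕ.<⇒<ᵇ i<j) | ¬T⇒false (j≮i ∘ ℕ.<ᵇ⇒< (toℕ j) (toℕ i)) = refl
    ... | no _ | tri> i≮j _ j<i rewrite T⇒true (ℕ.<⇒<ᵇ j<i) | ¬T⇒false (i≮j ∘ ℕ.<ᵇ⇒< (toℕ i) (toℕ j)) = refl

    -- The ordered pairs from S split by `trichotomy` into two copies of the edges and the diagonal.
    -- The additive form avoids truncated subtraction.
    handshake : (S : Fin n → Bool) → 2 * numEdges (clique S) + numVerts S ≡ numVerts S * numVerts S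
    handshake S = begin
      2 * numEdges (clique S) + numVerts S
        ≡⟨ cong₂ (λ e v → 2 * e + v) edges≡ (numVerts-sum S) ⟩
      2 * upper + sum s
        ≡⟨ cong (λ e → e + sum s) (cong (upper +_) (trans (ℕ.+-identityʳ upper) lower≡)) ⟩
      (upper + lower) + sum s
        ≡⟨ cong ((upper + lower) +_) diagonal≡ ⟨
      (upper + lower) + diagonal
        ≡⟨ cong (_+ diagonal) (sum₂-+ (λ i j → lt i j * (s i * s j)) (λ i j → lt j i * (s i * s j))) ⟨
      sum (λ i → sum λ j → lt i j * (s i * s j) + lt j i * (s i * s j)) + diagonal
        ≡⟨ sum₂-+ (λ i j → lt i j * (s i * s j) + lt j i * (s i * s j)) (λ i j → δ i j * (s i * s j)) ⟨
      sum (λ i → sum λ j → (lt i j * (s i * s j) + lt j i * (s i * s j)) + δ i j * (s i * s j))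
        ≡⟨ sum₂-cong (λ i j → trans (collect (lt i j) (lt j i) (δ i j) (s i * s j))
             (trans (cong (_* (s i * s j)) (trichotomy i j)) (ℕ.*-identityˡ (s i * s j)))) ⟩
      sum (λ i → sum λ j → s i * s j)
        ≡⟨ sum-cong-≗ (λ i → *-distribˡ-sum (s i) s) ⟨
      sum (λ i → s i * sum s)
        ≡⟨ *-distribʳ-sum (sum s) s ⟨
      sum s * sum s
        ≡⟨ cong₂ _*_ (numVerts-sum S) (numVerts-sum S) ⟨
      numVerts S * numVerts S ∎
      where
      open ≡.≡-Reasoning
      s : Fin n → ℕ
      s i = ⟦ S i ⟧
      upper = sum (λ i → sum λ j → lt i j * (s i * s j))
      lower = sum (λ i → sum λ j → lt j i * (s i * s j))
      diagonal = sum (λ i → sum λ j → δ i j * (s i * s j))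
      sum₂-+ : ∀ (f g : Fin n → Fin n → ℕ) →
               sum (λ i → sum λ j → f i j + g i j) ≡ sum (λ i → sum (f i)) + sum (λ i → sum (g i))
      sum₂-+ f g = trans (sum-cong-≗ (λ i → ∑-distrib-+ (f i) (g i))) (∑-distrib-+ (λ i → sum (f i)) (λ i → sum (g i)))
      collect : ∀ a b c x → (a * x + b * x) + c * x ≡ ((a + b) + c) * x
      collect = ℕ-solve-∀
      edges≡ : numEdges (clique S) ≡ upper
      edges≡ = trans (numEdges-sum (clique S)) (sum₂-cong (λ i j →
        trans (⟦∧⟧ (toℕ i <ᵇ toℕ j) (S i ∧ S j)) (cong (lt i j *_) (⟦∧⟧ (S i) (S j)))))
      lower≡ : upper ≡ lower
      lower≡ = trans (∑-comm (λ i j → lt i j * (s i * s j))) (sum₂-cong (λ j i → cong (lt i j *_) (ℕ.*-comm (s i) (s j))))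
      diagonal≡ : diagonal ≡ sum s
      diagonal≡ = sum-cong-≗ (λ i → trans (sum-δ i (λ j → s i * s j)) (⟦⟧-idem (S i)))

    everything : Fin n → Bool
    everything _ = true

    numVerts-everything : numVerts everything ≡ n
    numVerts-everything = trans (numVerts-sum everything) (trans (sum-const n 1) (ℕ.*-identityʳ n))

    ⟦≟⟧ : ∀ {k} (x a : Fin k) → ⟦ ⌊ x Fin.≟ a ⌋ ⟧ ≡ δ x a
    ⟦≟⟧ x a with x Fin.≟ a
    ... | yes _ = refl
    ... | no _ = refl

    -- Every pair i < j carries exactly one colour, so exchanging the sums leaves the edge count of
    -- the complete graph.
    numEdges-parts : ∀ {k} (c : Partition k n) → 2 * sum (λ a → numEdges (part c a)) + n ≡ n * n
    numEdges-parts {k} c = trans (cong (λ e → 2 * e + n) parts≡)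
      (subst (λ v → 2 * numEdges (clique everything) + v ≡ v * v) numVerts-everything (handshake everything))
      where
      open ≡.≡-Reasoning
      sum-δ-1 : ∀ (x : Fin k) → sum (δ x) ≡ 1
      sum-δ-1 x = trans (sum-cong-≗ (λ a → sym (ℕ.*-identityʳ (δ x a)))) (sum-δ x (λ _ → 1))
      parts≡ : sum (λ a → numEdges (part c a)) ≡ numEdges (clique everything)
      parts≡ = begin
        sum (λ a → numEdges (part c a))
          ≡⟨ sum-cong-≗ (λ a → trans (numEdges-sum (part c a)) (sum₂-cong (λ i j →
               trans (⟦∧⟧ (toℕ i <ᵇ toℕ j) (part c a i j)) (cong (lt i j *_) (⟦≟⟧ (c i j) a))))) ⟩
        sum (λ a → sum λ i → sum λ j → lt i j * δ (c i j) a)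
          ≡⟨ ∑-comm (λ a i → sum λ j → lt i j * δ (c i j) a) ⟩
        sum (λ i → sum λ a → sum λ j → lt i j * δ (c i j) a)
          ≡⟨ sum-cong-≗ (λ i → ∑-comm (λ a j → lt i j * δ (c i j) a)) ⟩
        sum (λ i → sum λ j → sum λ a → lt i j * δ (c i j) a)
          ≡⟨ sum₂-cong (λ i j → trans (sym (*-distribˡ-sum (lt i j) (δ (c i j)))) (cong (lt i j *_) (sum-δ-1 (c i j)))) ⟩
        sum {n} (λ i → sum {n} λ j → lt i j * 1)
          ≡⟨ sum₂-cong {n} {n} (λ i j → ⟦∧⟧ (toℕ i <ᵇ toℕ j) true) ⟨
        sum {n} (λ i → sum {n} λ j → ⟦ (toℕ i <ᵇ toℕ j) ∧ true ⟧)
          ≡⟨ numEdges-sum (clique everything) ⟨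
        numEdges (clique everything) ∎

  -- Arithmetic of ratios

  ratio-mono : ∀ a v b d → 1 ≤ v → 1 ≤ d → a * d ≤ b * v → ratio a v ℚ.≤ ratio b d
  ratio-mono a (suc v) b (suc d) _ _ ad≤bv = ℚ.toℚᵘ-cancel-≤ (begin
    ℚ.toℚᵘ (ℚ.fromℚᵘ (ℚᵘ.mkℚᵘ (pos a) v))  ≃⟨ ℚ.toℚᵘ-fromℚᵘ (ℚᵘ.mkℚᵘ (pos a) v) ⟩
    ℚᵘ.mkℚᵘ (pos a) v                      ≤⟨ ℚᵘ.*≤* (≡.subst₂ ℤ._≤_ (ℤ.pos-* a (suc d)) (ℤ.pos-* b (suc v)) (+≤+ ad≤bv)) ⟩
    ℚᵘ.mkℚᵘ (pos b) d                      ≃⟨ ℚ.toℚᵘ-fromℚᵘ (ℚᵘ.mkℚᵘ (pos b) d) ⟨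
    ℚ.toℚᵘ (ℚ.fromℚᵘ (ℚᵘ.mkℚᵘ (pos b) d))  ∎)
    where open ℚᵘ.≤-Reasoning

  ratio-cong : ∀ a v b d → 1 ≤ v → 1 ≤ d → a * d ≡ b * v → ratio a v ≡ ratio b d
  ratio-cong a v b d 1≤v 1≤d eq = ℚ.≤-antisym
    (ratio-mono a v b d 1≤v 1≤d (ℕ.≤-reflexive eq)) (ratio-mono b d a v 1≤d 1≤v (ℕ.≤-reflexive (sym eq)))

  ratio-+ : ∀ a b d → ratio a (suc d) ℚ.+ ratio b (suc d) ≡ ratio (a + b) (suc d)
  ratio-+ a b d = ℚ.toℚᵘ-injective (begin
    ℚ.toℚᵘ (ratio a (suc d) ℚ.+ ratio b (suc d))
      ≈⟨ ℚ.toℚᵘ-homo-+ (ratio a (suc d)) (ratio b (suc d)) ⟩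
    ℚ.toℚᵘ (ratio a (suc d)) ℚᵘ.+ ℚ.toℚᵘ (ratio b (suc d))
      ≈⟨ ℚᵘ.+-cong (ℚ.toℚᵘ-fromℚᵘ (ℚᵘ.mkℚᵘ (pos a) d)) (ℚ.toℚᵘ-fromℚᵘ (ℚᵘ.mkℚᵘ (pos b) d)) ⟩
    ℚᵘ.mkℚᵘ (pos a) d ℚᵘ.+ ℚᵘ.mkℚᵘ (pos b) d
      ≈⟨ ℚᵘ.*≡* (common (pos a) (pos b) (pos (suc d))) ⟩
    ℚᵘ.mkℚᵘ (pos (a + b)) d
      ≈⟨ ℚ.toℚᵘ-fromℚᵘ (ℚᵘ.mkℚᵘ (pos (a + b)) d) ⟨
    ℚ.toℚᵘ (ratio (a + b) (suc d)) ∎)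
    where
    open SetoidReasoning ℚᵘ.≃-setoid
    common : ∀ x y z → (x ℤ.* z ℤ.+ y ℤ.* z) ℤ.* z ≡ (x ℤ.+ y) ℤ.* (z ℤ.* z)
    common = ℤ-solve-∀

  sumFin-ratio : ∀ k (f : Fin k → ℕ) d → sumFin k (λ a → ratio (f a) (suc d)) ≡ ratio (sum f) (suc d)
  sumFin-ratio zero f d = ratio-cong 0 1 0 (suc d) (s≤s z≤n) (s≤s z≤n) refl
  sumFin-ratio (suc k) f d = trans (cong (ratio (f zero) (suc d) ℚ.+_) (sumFin-ratio k (f ∘ suc) d))
    (ratio-+ (f zero) (sum (f ∘ suc)) d)

  sumFin-mono : ∀ k {f g : Fin k → ℚ} → (∀ a → f a ℚ.≤ g a) → sumFin k f ℚ.≤ sumFin k g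
  sumFin-mono zero f≤g = ℚ.≤-refl
  sumFin-mono (suc k) f≤g = ℚ.+-mono-≤ (f≤g zero) (sumFin-mono k (f≤g ∘ suc))

  -- Upper bound

  -- With a + d = t this is a (a + 2d + 1) + d (d + 1) = t (t + 1).
  product-bound-≤ : ∀ a b d → a + b ≡ suc ((a + d) + (a + d)) → a * b ≤ (a + d) * suc (a + d)
  product-bound-≤ a b d a+b≡ = ℕ.≤-trans (ℕ.≤-reflexive (cong (a *_) b≡))
    (ℕ.≤-trans (ℕ.m≤m+n _ (d * suc d)) (ℕ.≤-reflexive (square a d)))
    where
    regroup : ∀ a d → suc ((a + d) + (a + d)) ≡ a + suc (a + (d + d))
    regroup = ℕ-solve-∀
    b≡ : b ≡ suc (a + (d + d))
    b≡ = ℕ.+-cancelˡ-≡ a b _ (trans a+b≡ (regroup a d))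
    square : ∀ a d → a * suc (a + (d + d)) + d * suc d ≡ (a + d) * suc (a + d)
    square = ℕ-solve-∀

  -- Of two numbers with odd sum 2t + 1 one is at most t; by symmetry it may be taken as the first
  -- factor.
  product-bound : ∀ a b t → a + b ≡ suc (t + t) → a * b ≤ t * suc t
  product-bound a b t a+b≡ with a ℕ.≤? t
  ... | yes a≤t with ℕ.m≤n⇒∃[o]m+o≡n a≤t
  ...   | d , refl = product-bound-≤ a b d a+b≡
  product-bound a b t a+b≡ | no a≰t with ℕ.m≤n⇒∃[o]m+o≡n (ℕ.+-cancelˡ-≤ (suc t) b t
    (ℕ.≤-trans (ℕ.+-monoˡ-≤ b (ℕ.≰⇒> a≰t)) (ℕ.≤-reflexive a+b≡)))
  ...   | d , refl = ℕ.≤-trans (ℕ.≤-reflexive (ℕ.*-comm a b)) (product-bound-≤ b a d (trans (ℕ.+-comm b a) a+b≡))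

  -- E/v ≤ (E + t (t + 1)) / (2 (t + 1)) for the average degree E/v of a graph with v vertices and
  -- E/2 edges: as E ≤ v (v − 1), it suffices that (v − 1) (2 (t + 1) − v) ≤ t (t + 1).
  tangent : ∀ E v t → 1 ≤ v → E + v ≤ v * v → E * (2 * suc t) ≤ (E + t * suc t) * v
  tangent E (suc v) t _ E+v≤vv with suc v ℕ.≤? 2 * suc t
  -- For v > 2 (t + 1) the factor 2 (t + 1) - v would be negative, and comparing factor by factor
  -- suffices.
  ... | no v≰2t = ℕ.*-mono-≤ (ℕ.m≤m+n E (t * suc t)) (ℕ.<⇒≤ (ℕ.≰⇒> v≰2t))
  ... | yes v≤2t with ℕ.m≤n⇒∃[o]m+o≡n v≤2t
  ...   | w , v+w≡2t = begin
    E * (2 * suc t)                        ≡⟨ cong (E *_) v+w≡2t ⟨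
    E * (suc v + w)                        ≡⟨ ℕ.*-distribˡ-+ E (suc v) w ⟩
    E * suc v + E * w                      ≤⟨ ℕ.+-monoʳ-≤ (E * suc v) (ℕ.*-monoˡ-≤ w E≤) ⟩
    E * suc v + (v * suc v) * w            ≡⟨ cong (E * suc v +_) (shuffle v w) ⟩
    E * suc v + (v * w) * suc v            ≤⟨ ℕ.+-monoʳ-≤ (E * suc v) (ℕ.*-monoˡ-≤ (suc v) (product-bound v w t v+w≡)) ⟩
    E * suc v + (t * suc t) * suc v        ≡⟨ ℕ.*-distribʳ-+ (suc v) E (t * suc t) ⟨
    (E + t * suc t) * suc v                ∎
    where
    open ℕ.≤-Reasoning
    shuffle : ∀ v w → (v * suc v) * w ≡ (v * w) * suc v
    shuffle = ℕ-solve-∀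
    E≤ : E ≤ v * suc v
    E≤ = ℕ.+-cancelʳ-≤ (suc v) E (v * suc v) (ℕ.≤-trans E+v≤vv (ℕ.≤-reflexive (ℕ.+-comm (suc v) (v * suc v))))
    double : ∀ t → 2 * suc t ≡ suc (suc (t + t))
    double = ℕ-solve-∀
    v+w≡ : v + w ≡ suc (t + t)
    v+w≡ = ℕ.suc-injective (trans v+w≡2t (double t))

  subgraph-bound : ∀ {n} {G : Graph n} (H : Subgraph G) →
    2 * numEdges (edges H) + numVerts (verts H) ≤ numVerts (verts H) * numVerts (verts H)
  subgraph-bound H = ℕ.≤-trans (ℕ.+-monoˡ-≤ (numVerts (verts H)) (ℕ.*-monoʳ-≤ 2 (numEdges-mono inside)))
    (ℕ.≤-reflexive (handshake (verts H)))
    where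
    inside : ∀ i j → toℕ i < toℕ j → T (edges H i j) → T (clique (verts H) i j)
    inside i j i<j e with edges⊆ H i j i<j e
    ... | _ , vi , vj = Equivalence.from (T-∧ {verts H i} {verts H j}) (vi , vj)

  -- The tangent bound is linear in the number of edges, so its sum over the classes depends only on
  -- n, k and t. The hypothesis compares that sum with D, cleared of denominators and subtractions.
  sum-Mad≤ : ∀ {n k} t D → n * n + k * (t * suc t) ≤ n + D * (2 * suc t) →
    (c : Partition k n) (r : Fin k → ℚ) → (∀ a → IsMad (part c a) (r a)) → sumFin k r ℚ.≤ ratio D 1
  sum-Mad≤ {n} {k} t D bound c r mad = ℚ.≤-trans (sumFin-mono k each)
    -- The common denominator `2 * suc t` unfolds to the successor of `t + 1 * suc t`.
    (ℚ.≤-trans (ℚ.≤-reflexive (sumFin-ratio k f (t + 1 * suc t)))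
    (ratio-mono (sum f) (2 * suc t) D 1 (s≤s z≤n) (s≤s z≤n) (ℕ.≤-trans (ℕ.≤-reflexive (ℕ.*-identityʳ (sum f))) total)))
    where
    f : Fin k → ℕ
    f a = 2 * numEdges (part c a) + t * suc t
    each : ∀ a → r a ℚ.≤ ratio (f a) (2 * suc t)
    each a with mad a
    ... | (H , 1≤v , density≡r) , _ = subst (ℚ._≤ ratio (f a) (2 * suc t)) density≡r
      -- The bound is applied to the subgraph H attaining Mad; only then are its edges enlarged to
      -- those of the whole class.
      (ratio-mono (2 * numEdges (edges H)) (numVerts (verts H)) (f a) (2 * suc t) 1≤v (s≤s z≤n)
        (ℕ.≤-trans (tangent (2 * numEdges (edges H)) (numVerts (verts H)) t 1≤v (subgraph-bound H))
          (ℕ.*-monoˡ-≤ (numVerts (verts H)) (ℕ.+-monoˡ-≤ (t * suc t) (ℕ.*-monoʳ-≤ 2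
            (numEdges-mono (λ i j i<j e → proj₁ (edges⊆ H i j i<j e))))))))
    total : sum f ≤ D * (2 * suc t)
    total = ℕ.+-cancelˡ-≤ n (sum f) (D * (2 * suc t)) (ℕ.≤-trans (ℕ.≤-reflexive (begin
      n + sum f
        ≡⟨ cong (n +_) (∑-distrib-+ (λ a → 2 * numEdges (part c a)) (λ _ → t * suc t)) ⟩
      n + (sum (λ a → 2 * numEdges (part c a)) + sum {k} (λ _ → t * suc t))
        ≡⟨ cong₂ (λ x y → n + (x + y)) (sym (*-distribˡ-sum 2 (λ a → numEdges (part c a)))) (sum-const k (t * suc t)) ⟩
      n + (2 * sum (λ a → numEdges (part c a)) + k * (t * suc t))
        ≡⟨ rotate n (2 * sum (λ a → numEdges (part c a))) (k * (t * suc t)) ⟩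
      (2 * sum (λ a → numEdges (part c a)) + n) + k * (t * suc t)
        ≡⟨ cong (_+ k * (t * suc t)) (numEdges-parts c) ⟩
      n * n + k * (t * suc t) ∎)) bound)
      where
      open ≡.≡-Reasoning
      rotate : ∀ a b c → a + (b + c) ≡ (b + a) + c
      rotate = ℕ-solve-∀

  -- Colouring the edges by the lines of a linear space

  module LineColouring {n k r : ℕ} (S : LinearSpace (Fin n) (Fin k) (suc r)) (covered : Covered S) where
    open LinearSpace S

    on? : ∀ i a → Dec (i on a)
    on? i a = Fin.any? (λ t → pencil i t Fin.≟ a)

    points : Fin k → Fin n → Bool
    points a i = ⌊ on? i a ⌋

    on⇒points : ∀ i a → i on a → T (points a i)
    on⇒points i a = fromWitness {a? = on? i a}

    points⇒on : ∀ i a → T (points a i) → i on a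
    points⇒on i a = toWitness {a? = on? i a}

    colour : Partition k n
    colour i j with i Fin.≟ j
    -- A default for the diagonal, where there is no edge; such a line exists because pencils have
    -- size `suc r`.
    ... | yes _ = pencil i zero
    ... | no i≢j = proj₁ (line-through i j i≢j)

    colour⇒on : ∀ i j → i ≢ j → i on colour i j × j on colour i j
    colour⇒on i j i≢j with i Fin.≟ j
    ... | yes i≡j = contradiction i≡j i≢j
    ... | no i≢j = let _ , i-on , j-on , _ = line-through i j i≢j in i-on , j-on

    on⇒colour : ∀ i j a → i ≢ j → i on a → j on a → colour i j ≡ a
    on⇒colour i j a i≢j i-on j-on with i Fin.≟ j
    ... | yes i≡j = contradiction i≡j i≢j
    ... | no i≢j = let _ , _ , _ , unique = line-through i j i≢j in sym (unique a i-on j-on)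

    size : Fin k → ℕ
    size a = numVerts (points a)

    part⊆clique : ∀ a i j → toℕ i < toℕ j → T (part colour a i j) → T (clique (points a) i j)
    part⊆clique a i j i<j t with toWitness {a? = colour i j Fin.≟ a} t | colour⇒on i j (ℕ.<⇒≢ i<j ∘ cong toℕ)
    ... | refl | i-on , j-on = Equivalence.from (T-∧ {points a i} {points a j}) (on⇒points i a i-on , on⇒points j a j-on)

    clique⊆part : ∀ a i j → toℕ i < toℕ j → T (clique (points a) i j) → T (part colour a i j)
    clique⊆part a i j i<j t with Equivalence.to (T-∧ {points a i} {points a j}) t
    ... | ti , tj = fromWitness (on⇒colour i j a (ℕ.<⇒≢ i<j ∘ cong toℕ) (points⇒on i a ti) (points⇒on j a tj))

    1≤size : ∀ a → 1 ≤ size a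
    1≤size a with covered a
    ... | i , i-on = ℕ.≤-trans (ℕ.≤-reflexive (sym single)) (numVerts-mono contained)
      where
      single : numVerts (λ j → ⌊ j Fin.≟ i ⌋) ≡ 1
      single = trans (numVerts-sum (λ j → ⌊ j Fin.≟ i ⌋))
        (trans (sum-cong-≗ (λ j → trans (⟦≟⟧ {n} j i) (sym (ℕ.*-identityˡ (δ j i))))) (sum-δʳ (λ _ → 1) i))
      contained : ∀ j → T ⌊ j Fin.≟ i ⌋ → T (points a j)
      contained j t with toWitness {a? = j Fin.≟ i} t
      ... | refl = on⇒points i a i-on

    -- The class of a line with s points is a clique on them, of density s - 1. The edges of a
    -- subgraph H lie within the w vertices of H on the line, and w (w - 1) ≤ (s - 1) |V(H)| since w
    -- is at most s and at most |V(H)|.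
    line-isMad : ∀ a → IsMad (part colour a) (ratio (size a ∸ 1) 1)
    line-isMad a = (whole , 1≤size a , whole-density) , maximal
      where
      whole : Subgraph (part colour a)
      whole = record
        { verts = points a ; edges = part colour a
        ; edges⊆ = λ i j i<j e → e , Equivalence.to (T-∧ {points a i} {points a j}) (part⊆clique a i j i<j e) }
      part≡ : numEdges (part colour a) ≡ numEdges (clique (points a))
      part≡ = ℕ.≤-antisym (numEdges-mono (part⊆clique a)) (numEdges-mono (clique⊆part a))
      pred-* : ∀ s → (s ∸ 1) * s + s ≡ s * s
      pred-* zero = refl
      pred-* (suc s) = ℕ.+-comm (s * suc s) (suc s)
      dense : 2 * numEdges (part colour a) * 1 ≡ (size a ∸ 1) * size a
      dense = trans (ℕ.*-identityʳ _) (ℕ.+-cancelʳ-≡ (size a) _ _ (trans (cong (λ e → 2 * e + size a) part≡)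
        (trans (handshake (points a)) (sym (pred-* (size a))))))
      whole-density : density whole ≡ ratio (size a ∸ 1) 1
      whole-density = ratio-cong (2 * numEdges (part colour a)) (size a) (size a ∸ 1) 1 (1≤size a) (s≤s z≤n) dense
      maximal : ∀ H → 1 ≤ numVerts (verts H) → density H ℚ.≤ ratio (size a ∸ 1) 1
      maximal H 1≤v = ratio-mono (2 * numEdges (edges H)) (numVerts (verts H)) (size a ∸ 1) 1 1≤v (s≤s z≤n)
        (ℕ.≤-trans (ℕ.≤-reflexive (ℕ.*-identityʳ _)) (ℕ.≤-trans few (ℕ.*-mono-≤
          (ℕ.∸-monoˡ-≤ 1 (numVerts-mono {S = W} {points a} (λ i t → proj₂ (Equivalence.to (T-∧ {verts H i} {points a i}) t))))
          (numVerts-mono {S = W} {verts H} (λ i t → proj₁ (Equivalence.to (T-∧ {verts H i} {points a i}) t))))))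
        where
        W : Fin n → Bool
        W i = verts H i ∧ points a i
        inside : ∀ i j → toℕ i < toℕ j → T (edges H i j) → T (clique W i j)
        inside i j i<j e with edges⊆ H i j i<j e
        ... | e′ , vi , vj with Equivalence.to (T-∧ {points a i} {points a j}) (part⊆clique a i j i<j e′)
        ... | ai , aj = Equivalence.from (T-∧ {W i} {W j})
          ( Equivalence.from (T-∧ {verts H i} {points a i}) (vi , ai)
          , Equivalence.from (T-∧ {verts H j} {points a j}) (vj , aj))
        few : 2 * numEdges (edges H) ≤ (numVerts W ∸ 1) * numVerts W
        few = ℕ.+-cancelʳ-≤ (numVerts W) _ _ (ℕ.≤-trans (ℕ.+-monoˡ-≤ (numVerts W) (ℕ.*-monoʳ-≤ 2 (numEdges-mono inside)))
          (ℕ.≤-reflexive (trans (handshake W) (sym (pred-* (numVerts W))))))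

    -- A line through i occurs exactly once in the pencil of i. This turns line sizes into a sum
    -- that can be evaluated from the side of the points.
    points-sum : ∀ a i → ⟦ points a i ⟧ ≡ sum (λ t → δ (pencil i t) a)
    points-sum a i with on? i a
    ... | yes (t , refl) = sym (trans (sum-cong-≗ same) (sum-δʳ (λ _ → 1) t))
      where
      same : ∀ s → δ (pencil i s) (pencil i t) ≡ 1 * δ s t
      same s with s Fin.≟ t | pencil i s Fin.≟ pencil i t
      ... | yes _ | yes _ = refl
      ... | no _ | no _ = refl
      ... | yes s≡t | no miss = contradiction (cong (pencil i) s≡t) miss
      ... | no s≢t | yes hit = contradiction (pencil-injective i s t hit) s≢t
    ... | no ¬on = sym (trans (sum-cong-≗ none) (trans (sum-const (suc r) 0) (ℕ.*-zeroʳ (suc r))))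
      where
      none : ∀ s → δ (pencil i s) a ≡ 0
      none s with pencil i s Fin.≟ a
      ... | yes hit = contradiction (s , hit) ¬on
      ... | no _ = refl

    sum-size : sum size ≡ n * suc r
    sum-size = begin
      sum size
        ≡⟨ sum-cong-≗ (λ a → trans (numVerts-sum (points a)) (sum-cong-≗ (points-sum a))) ⟩
      sum (λ a → sum λ i → sum λ t → δ (pencil i t) a)
        ≡⟨ ∑-comm (λ a i → sum λ t → δ (pencil i t) a) ⟩
      sum (λ i → sum λ a → sum λ t → δ (pencil i t) a)
        ≡⟨ sum-cong-≗ (λ i → ∑-comm (λ a t → δ (pencil i t) a)) ⟩
      sum (λ i → sum λ t → sum (δ (pencil i t)))
        ≡⟨ sum₂-cong (λ i t → trans (sum-cong-≗ (λ a → sym (ℕ.*-identityʳ (δ (pencil i t) a)))) (sum-δ (pencil i t) (λ _ → 1))) ⟩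
      sum {n} (λ i → sum {suc r} λ t → 1)
        ≡⟨ sum-cong-≗ {n} (λ i → trans (sum-const (suc r) 1) (ℕ.*-identityʳ (suc r))) ⟩
      sum {n} (λ i → suc r)
        ≡⟨ sum-const n (suc r) ⟩
      n * suc r ∎
      where open ≡.≡-Reasoning

    sum-size∸1 : sum (λ a → size a ∸ 1) + k ≡ n * suc r
    sum-size∸1 = begin
      sum (λ a → size a ∸ 1) + k                 ≡⟨ cong (sum (λ a → size a ∸ 1) +_) (trans (sum-const k 1) (ℕ.*-identityʳ k)) ⟨
      sum (λ a → size a ∸ 1) + sum {k} (λ _ → 1) ≡⟨ ∑-distrib-+ (λ a → size a ∸ 1) (λ _ → 1) ⟨
      sum (λ a → size a ∸ 1 + 1)                 ≡⟨ sum-cong-≗ (λ a → ℕ.m∸n+n≡m (1≤size a)) ⟩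
      sum size                                   ≡⟨ sum-size ⟩
      n * suc r                                  ∎
      where open ≡.≡-Reasoning

    -- The two equations say that D is both the sum of |ℓ| - 1 over the lines, by counting
    -- incidences, and the value of the summed tangent bound.
    isM : ∀ t D → D + k ≡ n * suc r → n * n + k * (t * suc t) ≡ n + D * (2 * suc t) → IsM k n (ratio D 1)
    isM t D D+k≡ tight = (colour , (λ a → ratio (size a ∸ 1) 1) , line-isMad , sum≡) , sum-Mad≤ t D (ℕ.≤-reflexive tight)
      where
      sum≡ : sumFin k (λ a → ratio (size a ∸ 1) 1) ≡ ratio D 1
      sum≡ = trans (sumFin-ratio k (λ a → size a ∸ 1) 0)
        (cong (λ d → ratio d 1) (ℕ.+-cancelʳ-≡ k _ _ (trans sum-size∸1 (sym D+k≡))))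

  -- In terms of m = q − 2, all five values of M are monic cubics.
  cubic : ℕ → ℕ → ℕ → ℕ → ℕ
  cubic a b c m = m * (m * (m + a) + b) + c

  pos-cubic : ∀ a b c m → pos (cubic a b c m) ≡ pos m ℤ.* (pos m ℤ.* (pos m ℤ.+ pos a) ℤ.+ pos b) ℤ.+ pos c
  pos-cubic a b c m = cong (ℤ._+ pos c) (trans (ℤ.pos-* m (m * (m + a) + b))
    (cong (λ z → pos m ℤ.* (z ℤ.+ pos b)) (ℤ.pos-* m (m + a))))

  -- The sizes coming from the enumerations match the required ones only up to polynomial
  -- identities; collecting these as arguments leaves ring identities in m alone.
  linear-space⇒isM : ∀ {n k n′ k′ r} (S : LinearSpace (Fin n) (Fin k) (suc r)) → Covered S → n ≡ n′ → k ≡ k′ →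
    ∀ t D {Z} → D + k ≡ n * suc r → n * n + k * (t * suc t) ≡ n + D * (2 * suc t) → pos D ≡ Z → IsM k′ n′ (ℤtoℚ Z)
  linear-space⇒isM S covered refl refl t D incidences tight refl = LineColouring.isM S covered t D incidences tight

  -- The five planes and their numerical identities

  module Cases (m : ℕ) (oa : OrthogonalArray (2 + m)) where
    open Planes oa
    private
      q = 2 + m
      Q : ℤ
      Q = pos q

      affine-enumerated = enumerated (enumerate-× q q) (enumerate-× (suc q) q) affine-plane
      affine-enumerated-thick = enumerated-thick (enumerate-× q q) (enumerate-× (suc q) q) affine-plane affine-thick

      points = enumerate-⊎ (suc q) (enumerate-× q q)
      lines = enumerate-⊎ 1 (enumerate-× (suc q) q)
      projective-enumerated = enumerated points lines projective-plane
      projective-enumerated-thick = enumerated-thick points lines projective-plane projective-thick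

    projective-isM : IsM (q * q + q + 1) (q * q + q + 1) (ℤtoℚ ((Q ℤ.* Q ℤ.+ Q ℤ.+ pos 1) ℤ.* Q))
    projective-isM = linear-space⇒isM projective-enumerated (thick⇒covered projective-enumerated projective-enumerated-thick)
      -- All lines have q + 1 points, the upper equality case for `suc t` = q = 2 + m.
      (n≡ m) (k≡ m) (1 + m) (cubic 7 17 14 m) (incidences m) (tight m) (trans (pos-cubic 7 17 14 m) (value (pos m)))
      where
      n≡ : ∀ m → (2 + m) * (2 + m) + (3 + m) ≡ (2 + m) * (2 + m) + (2 + m) + 1
      n≡ = ℕ-solve-∀
      k≡ : ∀ m → (3 + m) * (2 + m) + 1 ≡ (2 + m) * (2 + m) + (2 + m) + 1
      k≡ = ℕ-solve-∀
      incidences : ∀ m → (m * (m * (m + 7) + 17) + 14) + ((3 + m) * (2 + m) + 1) ≡ ((2 + m) * (2 + m) + (3 + m)) * (3 + m)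
      incidences = ℕ-solve-∀
      tight : ∀ m → ((2 + m) * (2 + m) + (3 + m)) * ((2 + m) * (2 + m) + (3 + m))
                    + ((3 + m) * (2 + m) + 1) * ((1 + m) * (2 + m))
                  ≡ ((2 + m) * (2 + m) + (3 + m)) + (m * (m * (m + 7) + 17) + 14) * (2 * (2 + m))
      tight = ℕ-solve-∀
      value : ∀ x → x ℤ.* (x ℤ.* (x ℤ.+ pos 7) ℤ.+ pos 17) ℤ.+ pos 14
                  ≡ ((pos 2 ℤ.+ x) ℤ.* (pos 2 ℤ.+ x) ℤ.+ (pos 2 ℤ.+ x) ℤ.+ pos 1) ℤ.* (pos 2 ℤ.+ x)
      value = ℤ-solve-∀

    affine-isM : IsM (q * q + q) (q * q) (ℤtoℚ ((Q ℤ.+ pos 1) ℤ.* Q ℤ.* (Q ℤ.- pos 1)))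
    affine-isM = linear-space⇒isM affine-enumerated (thick⇒covered affine-enumerated affine-enumerated-thick)
      -- All lines have q points, the lower equality case for the same `suc t` = q.
      refl (k≡ m) (1 + m) (cubic 6 11 6 m) (incidences m) (tight m) (trans (pos-cubic 6 11 6 m) (value (pos m)))
      where
      k≡ : ∀ m → (3 + m) * (2 + m) ≡ (2 + m) * (2 + m) + (2 + m)
      k≡ = ℕ-solve-∀
      incidences : ∀ m → (m * (m * (m + 6) + 11) + 6) + (3 + m) * (2 + m) ≡ ((2 + m) * (2 + m)) * (3 + m)
      incidences = ℕ-solve-∀
      tight : ∀ m → ((2 + m) * (2 + m)) * ((2 + m) * (2 + m)) + ((3 + m) * (2 + m)) * ((1 + m) * (2 + m))
                  ≡ (2 + m) * (2 + m) + (m * (m * (m + 6) + 11) + 6) * (2 * (2 + m))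
      tight = ℕ-solve-∀
      value : ∀ x → x ℤ.* (x ℤ.* (x ℤ.+ pos 6) ℤ.+ pos 11) ℤ.+ pos 6
                  ≡ ((pos 2 ℤ.+ x) ℤ.+ pos 1) ℤ.* (pos 2 ℤ.+ x) ℤ.* ((pos 2 ℤ.+ x) ℤ.- pos 1)
      value = ℤ-solve-∀

    projective-minus-point-isM : IsM (q * q + q + 1) (q * q + q) (ℤtoℚ (Q ℤ.* Q ℤ.* Q ℤ.+ Q ℤ.* Q ℤ.- pos 1))
    projective-minus-point-isM = linear-space⇒isM (delete-point projective-enumerated)
      (delete-point-covered projective-enumerated projective-enumerated-thick)
      -- Lines through the deleted point drop to q points and the others keep q + 1, so both
      -- equality cases for `suc t` = q occur.
      (n≡ m) (k≡ m) (1 + m) (cubic 7 16 11 m) (incidences m) (tight m) (trans (pos-cubic 7 16 11 m) (value (pos m)))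
      where
      -- The product q q unfolds to the successor of (1 + m) + (1 + m) (2 + m); the deleted point is
      -- that successor.
      n≡ : ∀ m → ((1 + m) + (1 + m) * (2 + m)) + (3 + m) ≡ (2 + m) * (2 + m) + (2 + m)
      n≡ = ℕ-solve-∀
      k≡ : ∀ m → (3 + m) * (2 + m) + 1 ≡ (2 + m) * (2 + m) + (2 + m) + 1
      k≡ = ℕ-solve-∀
      incidences : ∀ m → (m * (m * (m + 7) + 16) + 11) + ((3 + m) * (2 + m) + 1) ≡ (((1 + m) + (1 + m) * (2 + m)) + (3 + m)) * (3 + m)
      incidences = ℕ-solve-∀
      tight : ∀ m → (((1 + m) + (1 + m) * (2 + m)) + (3 + m)) * (((1 + m) + (1 + m) * (2 + m)) + (3 + m))
                    + ((3 + m) * (2 + m) + 1) * ((1 + m) * (2 + m))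
                  ≡ (((1 + m) + (1 + m) * (2 + m)) + (3 + m)) + (m * (m * (m + 7) + 16) + 11) * (2 * (2 + m))
      tight = ℕ-solve-∀
      value : ∀ x → x ℤ.* (x ℤ.* (x ℤ.+ pos 7) ℤ.+ pos 16) ℤ.+ pos 11
                  ≡ (pos 2 ℤ.+ x) ℤ.* (pos 2 ℤ.+ x) ℤ.* (pos 2 ℤ.+ x) ℤ.+ (pos 2 ℤ.+ x) ℤ.* (pos 2 ℤ.+ x) ℤ.- pos 1
      value = ℤ-solve-∀

    affine-minus-point-isM : ∀ n → n + 1 ≡ q * q → IsM (q * q + q) n (ℤtoℚ (Q ℤ.* Q ℤ.* Q ℤ.- pos 2 ℤ.* Q ℤ.- pos 1))
    affine-minus-point-isM n n+1≡ = linear-space⇒isM (delete-point affine-enumerated)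
      (delete-point-covered affine-enumerated affine-enumerated-thick)
      -- Line sizes are now q - 1 and q, so the bound is taken at `suc t` = q - 1 = 1 + m.
      (sym (ℕ.suc-injective (trans (ℕ.+-comm 1 n) n+1≡))) (k≡ m) m (cubic 6 10 3 m) (incidences m) (tight m)
      (trans (pos-cubic 6 10 3 m) (value (pos m)))
      where
      k≡ : ∀ m → (3 + m) * (2 + m) ≡ (2 + m) * (2 + m) + (2 + m)
      k≡ = ℕ-solve-∀
      incidences : ∀ m → (m * (m * (m + 6) + 10) + 3) + (3 + m) * (2 + m) ≡ ((1 + m) + (1 + m) * (2 + m)) * (3 + m)
      incidences = ℕ-solve-∀
      tight : ∀ m → ((1 + m) + (1 + m) * (2 + m)) * ((1 + m) + (1 + m) * (2 + m)) + ((3 + m) * (2 + m)) * (m * (1 + m))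
                  ≡ ((1 + m) + (1 + m) * (2 + m)) + (m * (m * (m + 6) + 10) + 3) * (2 * (1 + m))
      tight = ℕ-solve-∀
      value : ∀ x → x ℤ.* (x ℤ.* (x ℤ.+ pos 6) ℤ.+ pos 10) ℤ.+ pos 3
                  ≡ (pos 2 ℤ.+ x) ℤ.* (pos 2 ℤ.+ x) ℤ.* (pos 2 ℤ.+ x) ℤ.- pos 2 ℤ.* (pos 2 ℤ.+ x) ℤ.- pos 1
      value = ℤ-solve-∀

    affine-minus-line-isM : ∀ n k → n + q ≡ q * q → k + 1 ≡ q * q + q →
      IsM k n (ℤtoℚ (Q ℤ.* Q ℤ.* Q ℤ.- Q ℤ.* Q ℤ.- pos 2 ℤ.* Q ℤ.+ pos 1))
    affine-minus-line-isM n k n+q≡ k+1≡ = linear-space⇒isM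
      (enumerated points′ lines′ punctured-plane) (enumerated-covered points′ lines′ punctured-plane punctured-covered)
      (sym (ℕ.+-cancelʳ-≡ q n _ (trans n+q≡ (ℕ.+-comm q ((1 + m) * q)))))
      -- Lines parallel to the removed one keep q points and all others lose one, so again `suc t` =
      -- q - 1.
      (sym (ℕ.+-cancelʳ-≡ 1 k _ (trans k+1≡ (k≡ m)))) m (cubic 5 6 1 m) (incidences m) (tight m)
      (trans (pos-cubic 5 6 1 m) (value (pos m)))
      where
      points′ = enumerate-× (1 + m) q
      lines′ = enumerate-⊎ (1 + m) (enumerate-× q q)
      k≡ : ∀ m → (2 + m) * (2 + m) + (2 + m) ≡ ((2 + m) * (2 + m) + (1 + m)) + 1
      k≡ = ℕ-solve-∀
      incidences : ∀ m → (m * (m * (m + 5) + 6) + 1) + ((2 + m) * (2 + m) + (1 + m)) ≡ ((1 + m) * (2 + m)) * (3 + m)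
      incidences = ℕ-solve-∀
      tight : ∀ m → ((1 + m) * (2 + m)) * ((1 + m) * (2 + m)) + ((2 + m) * (2 + m) + (1 + m)) * (m * (1 + m))
                  ≡ (1 + m) * (2 + m) + (m * (m * (m + 5) + 6) + 1) * (2 * (1 + m))
      tight = ℕ-solve-∀
      value : ∀ x → x ℤ.* (x ℤ.* (x ℤ.+ pos 5) ℤ.+ pos 6) ℤ.+ pos 1
                  ≡ (pos 2 ℤ.+ x) ℤ.* (pos 2 ℤ.+ x) ℤ.* (pos 2 ℤ.+ x) ℤ.- (pos 2 ℤ.+ x) ℤ.* (pos 2 ℤ.+ x)
                    ℤ.- pos 2 ℤ.* (pos 2 ℤ.+ x) ℤ.+ pos 1
      value = ℤ-solve-∀

  prime-power≥2 : ∀ {q} → IsPrimePower q → 2 ℕ.≤ q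
  prime-power≥2 (p , suc e , p-prime , _ , refl) =
    ℕ.*-mono-≤ (ℕ.nonTrivial⇒n>1 p {{prime⇒nonTrivial p-prime}}) (ℕ.m^n>0 p {{prime⇒nonZero p-prime}} e)

  prime-power⇒orthogonalArray : ∀ {q} → IsPrimePower q → OrthogonalArray q
  prime-power⇒orthogonalArray (p , suc e , p-prime , _ , refl) = orthogonalArray (finite-field-of-order p-prime e)

open import Defs
open import Data.Nat using (ℕ; _≤_; suc; z≤n; s≤s)
open import Data.Nat.Combinatorics using (_C_)
open import Data.Product using (_×_; _,_)
open import Data.Integer using (+_; _+_; _-_; _*_)
open import Relation.Binary.PropositionalEquality using (_≡_; refl)
open Partitions using (module Cases; prime-power⇒orthogonalArray; prime-power≥2)

theorem6p2 : (q : ℕ) → IsPrimePower q →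
    ((n k : ℕ) → n ≡ q Data.Nat.* q Data.Nat.+ q Data.Nat.+ 1 → k ≡ n → k ≤ n C 2 →
    IsM k n (ℤtoℚ ((+ q * + q + + q + + 1) * + q))) ×
    ((n k : ℕ) → n ≡ q Data.Nat.* q → k ≡ q Data.Nat.* q Data.Nat.+ q → k ≤ n C 2 →
    IsM k n (ℤtoℚ ((+ q + + 1) * + q * (+ q - + 1)))) ×
    ((n k : ℕ) → n ≡ q Data.Nat.* q Data.Nat.+ q → k ≡ q Data.Nat.* q Data.Nat.+ q Data.Nat.+ 1 → k ≤ n C 2 →
    IsM k n (ℤtoℚ (+ q * + q * + q + + q * + q - + 1))) ×
    ((n k : ℕ) → n Data.Nat.+ 1 ≡ q Data.Nat.* q → k ≡ q Data.Nat.* q Data.Nat.+ q → k ≤ n C 2 →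
    IsM k n (ℤtoℚ (+ q * + q * + q - + 2 * + q - + 1))) ×
    ((n k : ℕ) → n Data.Nat.+ q ≡ q Data.Nat.* q → k Data.Nat.+ 1 ≡ q Data.Nat.* q Data.Nat.+ q → k ≤ n C 2 →
    IsM k n (ℤtoℚ (+ q * + q * + q - + q * + q - + 2 * + q + + 1)))
theorem6p2 q q-prime-power with prime-power⇒orthogonalArray q-prime-power | prime-power≥2 q-prime-power
theorem6p2 (suc (suc m)) _ | oa | s≤s (s≤s z≤n) =
  (λ { _ _ refl refl _ → projective-isM }) ,
  (λ { _ _ refl refl _ → affine-isM }) ,
  (λ { _ _ refl refl _ → projective-minus-point-isM }) ,
  (λ { n _ n+1≡ refl _ → affine-minus-point-isM n n+1≡ }) ,
  (λ n k n+q≡ k+1≡ _ → affine-minus-line-isM n k n+q≡ k+1≡)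
  where open Cases m oa
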